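{- Let $L$ be a logic with a normalised semantic specification $S_L$, and let $T_L$ be the tableau calculus generated from $S_L$. Then $T_L$ is sound for $L$; that is, for every (possibly infinite) set of concepts $\mathcal S$ that is satisfiable in an $L$-model, every finished tableau derivation $T_L(\mathcal S)$ is open.
   Context: **Object language.** Fix sorts $0,1,\dots,N$ (sort $1$ is primary). An object language $\mathcal L$ is given by a countable set of connectives, each $\sigma$ with a sort $(i_1,\dots,i_m,i_{m+1})$, $m\ge 0$, and by countable sets of variables $p^i_j$ and constants $q^i_j$ for each sort $i$. $\mathcal L^i$ is the smallest set containing the variables and constants of sort $i$ and containing $\sigma(E_1,\dots,E_m)$ whenever $\sigma$ has sort $(i_1,\dots,i_m,i)$ and $E_k\in\mathcal L^{i_k}$. $\mathcal L=\bigcup_i\mathcal L^i$ is the set of expressions; variables and constants are atomic; elements of $\mathcal L^0$ are individuals and of $\mathcal L^1$ concepts. $E(p_1,\dots,p_m)$ indicates variables of $E$, and $E(E_1,\dots,E_m)$ the result of uniform substitution. **Meta-language.** $FO(\mathcal L)$ is a many-sorted first-order language with sorts $0,\dots,N$ and a further domain sort $N+1$. Expressions of sort $i\le N$ are terms of sort $i$ (connectives are function symbols). There are also domain variables, domain constants, function symbols with values of domain sort, constant predicate symbols $P$ with arguments of domain sort, a function symbol $\nu_0$ from sort $0$ to the domain sort, predicate symbols $\nu_n$ ($1\le n\le N$) taking one argument of sort $n$ and $n$ arguments of domain sort, and equality $\approx$ on every sort (treated as an ordinary constant predicate symbol). An $\mathcal L$-open sentence is a formula in which all occurrences of variables of sorts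 $0,\dots,N$ are free and no domain variable is free. $\forall S$ is the set of universal closures of the members of $S$. **Structures.** An $\mathcal L$-structure $\mathcal I$ is a first-order interpretation of $FO(\mathcal L)$ in which sort $i\le N$ is interpreted by $\mathcal L^i$ itself (connectives as term formation) and the domain sort by a non-empty set $\Delta^{\mathcal I}$; so $\nu_0^{\mathcal I}(\ell)\in\Delta^{\mathcal I}$, $\nu_n^{\mathcal I}\subseteq\mathcal L^n\times(\Delta^{\mathcal I})^n$, $P^{\mathcal I}\subseteq(\Delta^{\mathcal I})^m$. **Semantic specification.** A semantic specification of $\mathcal L$ is a set $S$ of $\mathcal L$-open sentences, containing the usual equality axioms for $\approx$ (reflexivity, symmetry, transitivity, congruence for all $P$, $\nu_n$ and functions in domain arguments), which defines every connective: for each $\sigma$ of sort $(i_1,\dots,i_m,n)$ there is a formula $\phi^\sigma$ not containing $\sigma$ with $\forall S\models\forall\overline p\,\forall\overline x\,(\nu_n(\sigma(\overline p),\overline x)\equiv\phi^\sigma(\overline p,\overline x))$. It is normalised if $S=S^+\cup S^-\cup S^b$ (disjoint), where $S^+$ consists of sentences $\xi^E_+=\forall\overline x\,(\nu_n(E(\overline p),\overline x)\to\phi^E_+(\overline p,\overline x))$, $S^-$ of sentences $\xi^E_-=\forall\overline x\,(\phi^E_-(\overline p,\overline x)\to\nu_n(E(\overline p),\overline x))$ (at most one of each kind for each expression $E$), and all $\mathcal L$-expressions occurring in $S^b$ (the background theory, which includes the equality axioms) are atomic. **Logic, models.** A logic $L$ is a set of concepts closed under substitution; $S_L$ is a semantic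 specification of $L$ if $L$ is the set of concepts $C$ such that $\forall x\,\nu_1(C,x)$ holds (each variable and constant of $\mathcal L$ denoting itself) in all $\mathcal L$-structures satisfying $\forall S_L$. An $L$-model is an $\mathcal L$-structure satisfying $\forall S_L$. A set $\mathcal S$ of concepts is satisfiable in an $L$-model $\mathcal I$ if some $a\in\Delta^{\mathcal I}$ has $(C,a)\in\nu_1^{\mathcal I}$ for all $C\in\mathcal S$. **Tableaux.** A tableau calculus is a set of rules $X_0/X_1\mid\cdots\mid X_n$ with $X_i$ finite non-empty sets of literals of $FO(\mathcal L)$; if $n=0$ it is a closure rule, written $X_0/\bot$. A tableau is a finitely branching tree of sets of formulae; for an input set $\mathcal S$ of concepts the root is $\{\nu_1(C,a)\mid C\in\mathcal S\}$ with $a$ a fresh domain constant. A rule is applicable to a node if an instance of all its premises lies in the node ($\mathcal L$-variables are instantiated by expressions, domain variables by ground domain terms); it creates $n$ successors, the $i$-th adding the corresponding instance of $X_i$; each rule is applied at most once to the same premises. $T(\mathcal S)$ denotes a finished tableau (all applicable rules have been applied on all branches, in the limit). A branch is a maximal path, identified with the union of its nodes; it is closed if a closure rule has been applied on it, otherwise open. A tableau is closed if all its branches are closed, otherwise open. **The generated calculus $T_L$** consists of: (t1) for each $\xi^E_+\in S_L^+$: Skolemise and rewrite to $\forall\overline x(\nu_n(E(\overline p),\overline x)\to\bigvee_{j=1}^J\bigwedge_{k=1}^{K_j}\psi_{jk})$ with literals $\psi_{jk}$, and take the rule with premises $\nu_n(E(\overline p),\overline x),\,y_1\approx y_1,\dots,y_s\approx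 y_s$ (the $y_i$ being the free variables of the $\psi_{jk}$ not among $\overline x$) and denominators $\{\psi_{j1},\dots,\psi_{jK_j}\}$, $j=1,\dots,J$; for each $\xi^E_-\in S_L^-$ do the same with the contrapositive $\forall\overline x(\neg\nu_n(E(\overline p),\overline x)\to\bigvee_j\bigwedge_k\psi_{jk})$ and main premise $\neg\nu_n(E(\overline p),\overline x)$; (t2) for each non-equality sentence of $S_L^b$, rewritten in Skolemised disjunctive form $\forall\overline x\bigvee_j\bigwedge_k\psi_{jk}(\overline p,\overline x)$: the rule with premises $p_i\approx p_i$, $x_i\approx x_i$ (all variables occurring) and denominators $\{\psi_{j1},\dots,\psi_{jK_j}\}$; (t3) equality rules, for all predicates $P$ (including $\approx$), $\nu_n$ and functions $f$ (including Skolem functions) involved: $(\neg)P(\overline x)/x_1\approx x_1,\dots,x_n\approx x_n$; $(\neg)\nu_n(p,\overline x)/p\approx p,x_1\approx x_1,\dots,x_n\approx x_n$; $x\approx y/y\approx x$; $x\approx y,\,y\approx z/x\approx z$; $P(\overline x),x_i\approx y_i/P(\dots,y_i,\dots)$; $\nu_n(p,\overline x),x_i\approx y_i/\nu_n(p,\dots,y_i,\dots)$; $f(\overline p,\overline x)\approx f(\overline p,\overline x),\,x_i\approx y_i/f(\overline p,\overline x)\approx f(\overline p,\dots,y_i,\dots)$; (t4) closure rules $\nu_n(p,\overline x),\neg\nu_n(p,\overline x)/\bot$ and $P(\overline x),\neg P(\overline x)/\bot$. -}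

module Defs where

open import Level using (Level; 0ℓ; _⊔_) renaming (suc to lsuc)
open import Data.Bool using (Bool; true; false)
open import Data.Empty using (⊥)
open import Data.Fin as Fin using (Fin; zero; suc; toℕ)
open import Data.List using (List; []; _∷_; _++_; [_]; map; concat; concatMap; filter; deduplicate; cartesianProductWith; length; lookup)
open import Data.List.Membership.Propositional using (_∈_; _∉_)
open import Data.List.Relation.Unary.All as All using (All; []; _∷_)
open import Data.Maybe using (Maybe; just; nothing)
open import Data.Nat as ℕ using (ℕ; zero; suc; _+_; _≤?_)
open import Data.Product using (Σ; ∃; ∃₂; ∃-syntax; _×_; _,_; proj₁; proj₂)
open import Data.Product.Properties using (≡-dec)
open import Data.Sum using (_⊎_)
open import Data.Unit using (⊤)
open import Data.Vec as Vec using (Vec; []; _∷_; tabulate; _[_]≔_)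
open import Function using (_∘_; Injective; _⇔_; _↣_)
open import Relation.Binary using (Rel; IsEquivalence; DecidableEquality)
open import Relation.Binary.PropositionalEquality using (_≡_; _≢_; refl)
open import Relation.Nullary using (¬_; yes; no; ¬?)
open import Relation.Unary using (Pred; _⊆_; _≐_; _∪_; _∩_; Empty)

-- The axiom of choice of the classical metatheory, in the form "every
-- equivalence relation has a system of representatives".
Choice : Set₁
Choice = ∀ {A : Set} (_~_ : Rel A 0ℓ) → IsEquivalence _~_ →
  Σ (A → A) λ r → (∀ x → r x ~ x) × (∀ {x y} → x ~ y → r x ≡ r y)

Countable : Set → Set
Countable A = A ↣ ℕ

-- The sorts are 0 , … , N with N = suc M (there always is a sort 1).
-- The variables of sort i are p^i_j with j : ℕ.
record Language : Set₁ where
  field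
    M               : ℕ
  Sort : Set
  Sort = Fin (suc (suc M))
  field
    Conn            : List Sort → Sort → Set
    Const           : Sort → Set
    Conn-countable  : Countable (∃₂ Conn)
    Const-countable : ∀ i → Countable (Const i)

module Object (𝓛 : Language) where
  open Language 𝓛 public

  data Expr : Sort → Set where
    var : ∀ {i} → ℕ → Expr i
    con : ∀ {i} → Const i → Expr i
    app : ∀ {is i} → Conn is i → All Expr is → Expr i

  Concept : Set
  Concept = Expr (suc zero)

  data Atomic : ∀ {i} → Expr i → Set where
    var : ∀ {i} (j : ℕ) → Atomic (var {i} j)
    con : ∀ {i} (q : Const i) → Atomic (con q)

  ObjVar : Set
  ObjVar = Sort × ℕ

  _≟ᵒ_ : DecidableEquality ObjVar
  _≟ᵒ_ = ≡-dec Fin._≟_ ℕ._≟_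

  varsᴱ  : ∀ {i} → Expr i → List ObjVar
  varsᴱs : ∀ {is} → All Expr is → List ObjVar
  varsᴱ {i} (var j)  = [ i , j ]
  varsᴱ (con q)      = []
  varsᴱ (app σ Es)   = varsᴱs Es
  varsᴱs []          = []
  varsᴱs (E ∷ Es)    = varsᴱ E ++ varsᴱs Es

  connsᴱ  : ∀ {i} → Expr i → List (∃₂ Conn)
  connsᴱs : ∀ {is} → All Expr is → List (∃₂ Conn)
  connsᴱ (var j)     = []
  connsᴱ (con q)     = []
  connsᴱ (app σ Es)  = (_ , _ , σ) ∷ connsᴱs Es
  connsᴱs []         = []
  connsᴱs (E ∷ Es)   = connsᴱ E ++ connsᴱs Es

  Subst : Set
  Subst = ∀ i → ℕ → Expr i

  infixl 8 _[_]ᴱ _[_]ᴱs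
  _[_]ᴱ  : ∀ {i} → Expr i → Subst → Expr i
  _[_]ᴱs : ∀ {is} → All Expr is → Subst → All Expr is
  var j [ s ]ᴱ       = s _ j
  con q [ s ]ᴱ       = con q
  app σ Es [ s ]ᴱ    = app σ (Es [ s ]ᴱs)
  [] [ s ]ᴱs         = []
  (E ∷ Es) [ s ]ᴱs   = E [ s ]ᴱ ∷ Es [ s ]ᴱs

  _[_↦_] : ∀ {i} → Subst → ℕ → Expr i → Subst
  _[_↦_] {i} s v E j w with i Fin.≟ j | v ℕ.≟ w
  ... | yes refl | yes refl = E
  ... | _        | _        = s j w

  -- A choice of pairwise distinct variables of each sort.
  record Naming : Set where
    field
      name     : Sort → ℕ → ℕ
      distinct : ∀ i → Injective _≡_ _≡_ (name i)

    v : ∀ {i} → ℕ → Expr i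
    v {i} j = var (name i j)

    vsFrom : ℕ → ∀ is → All Expr is
    vsFrom j []       = []
    vsFrom j (i ∷ is) = v j ∷ vsFrom (suc j) is

    -- The k-th entry is the k-th chosen variable of its sort, so the entries are
    -- pairwise distinct.
    vs : ∀ is → All Expr is
    vs = vsFrom 0

  canonical : Naming
  canonical = record { name = λ _ j → j ; distinct = λ _ e → e }

  varsFrom : ∀ (ws : List ObjVar) → All Expr (map proj₁ ws)
  varsFrom []              = []
  varsFrom ((i , j) ∷ ws)  = var j ∷ varsFrom ws

  record IsLogic {ℓ} (L : Pred Concept ℓ) : Set ℓ where
    field
      closed : ∀ {C} → L C → ∀ s → L (C [ s ]ᴱ)

-- The non-fixed symbols of FO(𝓛).  A function symbol f takes arguments of
-- the sorts objArgs f ≤ N followed by arity f domain arguments; domain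
-- constants are the case without arguments.
record Signature (𝓛 : Language) : Set₁ where
  open Language 𝓛
  field
    Fun     : Set
    objArgs : Fun → List Sort
    arity   : Fun → ℕ
    Prd     : Set
    parity  : Prd → ℕ

-- Formulas in which only domain variables may be bound (as in 𝓛-open
-- sentences), versus arbitrary formulas of FO(𝓛).
data Kind : Set where
  lopen full : Kind

module FO {𝓛 : Language} where
  open Object 𝓛

  -- Equality on the domain sort is one of the constant predicate symbols.
  data PredSym (Sg : Signature 𝓛) : Set where
    ≈ᵈ  : PredSym Sg
    prd : Signature.Prd Sg → PredSym Sg

  par : ∀ {Sg} → PredSym Sg → ℕ
  par      ≈ᵈ      = 2
  par {Sg} (prd P) = Signature.parity Sg P

  -- The sort of the first argument of ν_n is suc n here; its number of
  -- domain arguments is rank n.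
  rank : Fin (suc M) → ℕ
  rank n = suc (toℕ n)

  -- Terms of the domain sort, with domain variables from X.
  data Term (Sg : Signature 𝓛) (X : Set) : Set where
    var : X → Term Sg X
    ν₀  : Expr zero → Term Sg X
    fun : (f : Signature.Fun Sg) → All Expr (Signature.objArgs Sg f) →
          Vec (Term Sg X) (Signature.arity Sg f) → Term Sg X

  data Atom (Sg : Signature 𝓛) (X : Set) : Set where
    ν    : (n : Fin (suc M)) → Expr (suc n) → Vec (Term Sg X) (rank n) → Atom Sg X
    pred : (P : PredSym Sg) → Vec (Term Sg X) (par P) → Atom Sg X
    _≈ᵒ_ : ∀ {i} → Expr i → Expr i → Atom Sg X

  pattern _≐ᵈ_ t u = pred ≈ᵈ (t ∷ u ∷ [])

  data Literal (Sg : Signature 𝓛) (X : Set) : Set where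
    pos neg : Atom Sg X → Literal Sg X

  -- k is the number of domain variables in scope (de Bruijn indices).
  infixr 6 _∧′_
  infixr 5 _∨′_
  infixr 4 _⇒′_
  data Formula (Sg : Signature 𝓛) : Kind → ℕ → Set where
    atom           : ∀ {κ k} → Atom Sg (Fin k) → Formula Sg κ k
    ⊤′ ⊥′          : ∀ {κ k} → Formula Sg κ k
    ¬′_            : ∀ {κ k} → Formula Sg κ k → Formula Sg κ k
    _∧′_ _∨′_ _⇒′_ : ∀ {κ k} → Formula Sg κ k → Formula Sg κ k → Formula Sg κ k
    ∀′_ ∃′_        : ∀ {κ k} → Formula Sg κ (suc k) → Formula Sg κ k
    ∀ᵒ ∃ᵒ          : ∀ {k} → ObjVar → Formula Sg full k → Formula Sg full k

  Sentence : Signature 𝓛 → Set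
  Sentence Sg = Formula Sg lopen 0

  module _ {Sg : Signature 𝓛} where

    signed : ∀ {X} → Bool → Atom Sg X → Literal Sg X
    signed true  = pos
    signed false = neg

    infixr 4 _⇔′_
    _⇔′_ : ∀ {κ k} → Formula Sg κ k → Formula Sg κ k → Formula Sg κ k
    φ ⇔′ ψ = (φ ⇒′ ψ) ∧′ (ψ ⇒′ φ)

    ∀* : ∀ {κ} k → Formula Sg κ k → Formula Sg κ 0
    ∀* zero    φ = φ
    ∀* (suc k) φ = ∀* k (∀′ φ)

    x̄ : ∀ {k} → Vec (Term Sg (Fin k)) k
    x̄ = tabulate var

    exprsᵀ  : ∀ {X} → Term Sg X → List (∃ Expr)
    exprsᵀs : ∀ {X n} → Vec (Term Sg X) n → List (∃ Expr)
    exprsᵀ (var x)       = []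
    exprsᵀ (ν₀ E)        = [ _ , E ]
    exprsᵀ (fun f Es ts) = All.reduce (_ ,_) Es ++ exprsᵀs ts
    exprsᵀs []           = []
    exprsᵀs (t ∷ ts)     = exprsᵀ t ++ exprsᵀs ts

    exprsᴬ : ∀ {X} → Atom Sg X → List (∃ Expr)
    exprsᴬ (ν n E ts)  = (_ , E) ∷ exprsᵀs ts
    exprsᴬ (pred P ts) = exprsᵀs ts
    exprsᴬ (E ≈ᵒ F)    = (_ , E) ∷ (_ , F) ∷ []

    atomOf : ∀ {X} → Literal Sg X → Atom Sg X
    atomOf (pos A) = A
    atomOf (neg A) = A

    domVarsᵀ  : ∀ {X} → Term Sg X → List X
    domVarsᵀs : ∀ {X n} → Vec (Term Sg X) n → List X
    domVarsᵀ (var x)       = [ x ]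
    domVarsᵀ (ν₀ E)        = []
    domVarsᵀ (fun f Es ts) = domVarsᵀs ts
    domVarsᵀs []           = []
    domVarsᵀs (t ∷ ts)     = domVarsᵀ t ++ domVarsᵀs ts

    domVarsᴬ : ∀ {X} → Atom Sg X → List X
    domVarsᴬ (ν n E ts)  = domVarsᵀs ts
    domVarsᴬ (pred P ts) = domVarsᵀs ts
    domVarsᴬ (E ≈ᵒ F)    = []

    varsᴬ : ∀ {X} → Atom Sg X → List ObjVar
    varsᴬ A = concatMap (varsᴱ ∘ proj₂) (exprsᴬ A)

    exprs : ∀ {κ k} → Formula Sg κ k → List (∃ Expr)
    exprs (atom A)  = exprsᴬ A
    exprs ⊤′        = []
    exprs ⊥′        = []
    exprs (¬′ φ)    = exprs φ
    exprs (φ ∧′ ψ)  = exprs φ ++ exprs ψ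
    exprs (φ ∨′ ψ)  = exprs φ ++ exprs ψ
    exprs (φ ⇒′ ψ)  = exprs φ ++ exprs ψ
    exprs (∀′ φ)    = exprs φ
    exprs (∃′ φ)    = exprs φ
    exprs (∀ᵒ w φ)  = exprs φ
    exprs (∃ᵒ w φ)  = exprs φ

    conns : ∀ {κ k} → Formula Sg κ k → List (∃₂ Conn)
    conns φ = concatMap (connsᴱ ∘ proj₂) (exprs φ)

    freeObj : ∀ {κ k} → Formula Sg κ k → List ObjVar
    freeObj (atom A)  = varsᴬ A
    freeObj ⊤′        = []
    freeObj ⊥′        = []
    freeObj (¬′ φ)    = freeObj φ
    freeObj (φ ∧′ ψ)  = freeObj φ ++ freeObj ψ
    freeObj (φ ∨′ ψ)  = freeObj φ ++ freeObj ψ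
    freeObj (φ ⇒′ ψ)  = freeObj φ ++ freeObj ψ
    freeObj (∀′ φ)    = freeObj φ
    freeObj (∃′ φ)    = freeObj φ
    freeObj (∀ᵒ w φ)  = filter (λ u → ¬? (u ≟ᵒ w)) (freeObj φ)
    freeObj (∃ᵒ w φ)  = filter (λ u → ¬? (u ≟ᵒ w)) (freeObj φ)

    infixl 8 _[_,_]ᵀ _[_,_]ᵀs _[_,_]ᴬ _[_,_]ᴸ
    _[_,_]ᵀ  : ∀ {X Y} → Term Sg X → Subst → (X → Term Sg Y) → Term Sg Y
    _[_,_]ᵀs : ∀ {X Y n} → Vec (Term Sg X) n → Subst → (X → Term Sg Y) → Vec (Term Sg Y) n
    var x [ s , τ ]ᵀ       = τ x
    ν₀ E [ s , τ ]ᵀ        = ν₀ (E [ s ]ᴱ)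
    fun f Es ts [ s , τ ]ᵀ = fun f (Es [ s ]ᴱs) (ts [ s , τ ]ᵀs)
    [] [ s , τ ]ᵀs         = []
    (t ∷ ts) [ s , τ ]ᵀs   = t [ s , τ ]ᵀ ∷ ts [ s , τ ]ᵀs

    _[_,_]ᴬ : ∀ {X Y} → Atom Sg X → Subst → (X → Term Sg Y) → Atom Sg Y
    ν n E ts [ s , τ ]ᴬ    = ν n (E [ s ]ᴱ) (ts [ s , τ ]ᵀs)
    pred P ts [ s , τ ]ᴬ   = pred P (ts [ s , τ ]ᵀs)
    (E ≈ᵒ F) [ s , τ ]ᴬ    = (E [ s ]ᴱ) ≈ᵒ (F [ s ]ᴱ)

    _[_,_]ᴸ : ∀ {X Y} → Literal Sg X → Subst → (X → Term Sg Y) → Literal Sg Y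
    pos A [ s , τ ]ᴸ       = pos (A [ s , τ ]ᴬ)
    neg A [ s , τ ]ᴸ       = neg (A [ s , τ ]ᴬ)

  -- Sort i ≤ N is interpreted by the term algebra Expr i; in particular the
  -- constants of the object language denote themselves.  The equality
  -- symbols are interpreted by arbitrary relations, subject to the equality
  -- axioms of the specification only.
  record Structure (Sg : Signature 𝓛) : Set₁ where
    open Signature Sg
    field
      Δ        : Set
      nonempty : Δ
      ν₀ᴵ      : Expr zero → Δ
      νᴵ       : (n : Fin (suc M)) → Expr (suc n) → Vec Δ (rank n) → Set
      funᴵ     : (f : Fun) → All Expr (objArgs f) → Vec Δ (arity f) → Δ
      predᴵ    : (P : PredSym Sg) → Vec Δ (par P) → Set
      eqᴵ      : ∀ i → Expr i → Expr i → Set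

    ⟦_⟧ᵀ  : ∀ {X} → Term Sg X → Subst → (X → Δ) → Δ
    ⟦_⟧ᵀs : ∀ {X n} → Vec (Term Sg X) n → Subst → (X → Δ) → Vec Δ n
    ⟦ var x ⟧ᵀ s ρ       = ρ x
    ⟦ ν₀ E ⟧ᵀ s ρ        = ν₀ᴵ (E [ s ]ᴱ)
    ⟦ fun f Es ts ⟧ᵀ s ρ = funᴵ f (Es [ s ]ᴱs) (⟦ ts ⟧ᵀs s ρ)
    ⟦ [] ⟧ᵀs s ρ         = []
    ⟦ t ∷ ts ⟧ᵀs s ρ     = ⟦ t ⟧ᵀ s ρ ∷ ⟦ ts ⟧ᵀs s ρ

    ⟦_⟧ᴬ : ∀ {X} → Atom Sg X → Subst → (X → Δ) → Set
    ⟦ ν n E ts ⟧ᴬ s ρ      = νᴵ n (E [ s ]ᴱ) (⟦ ts ⟧ᵀs s ρ)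
    ⟦ pred P ts ⟧ᴬ s ρ     = predᴵ P (⟦ ts ⟧ᵀs s ρ)
    ⟦ _≈ᵒ_ {i} E F ⟧ᴬ s ρ  = eqᴵ i (E [ s ]ᴱ) (F [ s ]ᴱ)

    -- A substitution is a valuation of the variables of sorts 0 , … , N.
    ⟦_⟧ : ∀ {κ k} → Formula Sg κ k → Subst → Vec Δ k → Set
    ⟦ atom A ⟧ s ρ          = ⟦ A ⟧ᴬ s (Vec.lookup ρ)
    ⟦ ⊤′ ⟧ s ρ              = ⊤
    ⟦ ⊥′ ⟧ s ρ              = ⊥
    ⟦ ¬′ φ ⟧ s ρ            = ¬ ⟦ φ ⟧ s ρ
    ⟦ φ ∧′ ψ ⟧ s ρ          = ⟦ φ ⟧ s ρ × ⟦ ψ ⟧ s ρ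
    ⟦ φ ∨′ ψ ⟧ s ρ          = ⟦ φ ⟧ s ρ ⊎ ⟦ ψ ⟧ s ρ
    ⟦ φ ⇒′ ψ ⟧ s ρ          = ⟦ φ ⟧ s ρ → ⟦ ψ ⟧ s ρ
    ⟦ ∀′ φ ⟧ s ρ            = ∀ d → ⟦ φ ⟧ s (d ∷ ρ)
    ⟦ ∃′ φ ⟧ s ρ            = ∃[ d ] ⟦ φ ⟧ s (d ∷ ρ)
    ⟦ ∀ᵒ (i , w) φ ⟧ s ρ    = ∀ (E : Expr i) → ⟦ φ ⟧ (s [ w ↦ E ]) ρ
    ⟦ ∃ᵒ (i , w) φ ⟧ s ρ    = Σ (Expr i) λ E → ⟦ φ ⟧ (s [ w ↦ E ]) ρ

  open Structure public using (Δ)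

  module _ {Sg : Signature 𝓛} where

    -- Truth of the universal closure.
    infix 3 _⊨∀_ _⊨∀ᴾ_
    _⊨∀_ : ∀ {κ} → Structure Sg → Formula Sg κ 0 → Set
    I ⊨∀ φ = ∀ s → Structure.⟦_⟧ I φ s []

    _⊨∀ᴾ_ : Structure Sg → Pred (Sentence Sg) 0ℓ → Set
    I ⊨∀ᴾ S = ∀ {φ} → S φ → I ⊨∀ φ

    _⊩_∶_ : (I : Structure Sg) → Δ I → Concept → Set
    I ⊩ a ∶ C = Structure.νᴵ I zero C (a ∷ [])

module Calculus {𝓛 : Language} (Sg : Signature 𝓛) where
  open Object 𝓛
  open FO {𝓛}
  open Signature Sg

  data EqAxiom : Set where
    reflᵒ symᵒ transᵒ : Sort → EqAxiom
    reflᵈ symᵈ transᵈ : EqAxiom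
    congν             : (n : Fin (suc M)) → Fin (rank n) → EqAxiom
    congᴾ             : (P : Prd) → Fin (parity P) → EqAxiom
    congᶠ             : (f : Fun) → Fin (arity f) → EqAxiom

  -- Object variables are free in these sentences, and may be chosen at will.
  -- In the congruence axioms, y is variable 0 and x̄ are the others.
  eqAxiom : EqAxiom → Naming → Sentence Sg
  eqAxiom a V = go a
    where
    open Naming V
    y : ∀ {k} → Term Sg (Fin (suc k))
    y = var zero
    xs : ∀ {k} → Vec (Term Sg (Fin (suc k))) k
    xs = tabulate (λ j → var (suc j))
    go : EqAxiom → Sentence Sg
    go (reflᵒ i)   = atom (v {i} 0 ≈ᵒ v 0)
    go (symᵒ i)    = atom (v {i} 0 ≈ᵒ v 1) ⇒′ atom (v {i} 1 ≈ᵒ v 0)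
    go (transᵒ i)  = atom (v {i} 0 ≈ᵒ v 1) ∧′ atom (v {i} 1 ≈ᵒ v 2) ⇒′ atom (v {i} 0 ≈ᵒ v 2)
    go reflᵈ       = ∀* 1 (atom (y ≐ᵈ y))
    go symᵈ        = ∀* 2 (atom (var zero ≐ᵈ var (suc zero)) ⇒′ atom (var (suc zero) ≐ᵈ var zero))
    go transᵈ      = ∀* 3 (atom (var zero ≐ᵈ var (suc zero)) ∧′ atom (var (suc zero) ≐ᵈ var (suc (suc zero)))
                             ⇒′ atom (var zero ≐ᵈ var (suc (suc zero))))
    go (congν n i) = ∀* (suc (rank n)) (atom (ν n (v 0) xs) ∧′ atom (Vec.lookup xs i ≐ᵈ y)
                             ⇒′ atom (ν n (v 0) (xs [ i ]≔ y)))
    go (congᴾ P i) = ∀* (suc (parity P)) (atom (pred (prd P) xs) ∧′ atom (Vec.lookup xs i ≐ᵈ y)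
                             ⇒′ atom (pred (prd P) (xs [ i ]≔ y)))
    go (congᶠ f i) = ∀* (suc (arity f)) (atom (Vec.lookup xs i ≐ᵈ y)
                             ⇒′ atom (fun f (vs (objArgs f)) xs ≐ᵈ fun f (vs (objArgs f)) (xs [ i ]≔ y)))

  IsEqAxiom : Pred (Sentence Sg) 0ℓ
  IsEqAxiom φ = ∃[ a ] ∃[ V ] φ ≡ eqAxiom a V

  HasEqAxioms : Pred (Sentence Sg) 0ℓ → Set
  HasEqAxioms S = ∀ a → ∃[ V ] S (eqAxiom a V)

  -- φ^σ may bind object variables, its free ones are among p̄.  Connectives
  -- of result sort 0 are exempt, as ν_n is a predicate for n ≥ 1 only.
  Defines : Pred (Sentence Sg) 0ℓ → ∀ {is n} → Conn is (suc n) → Set₁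
  Defines S {is} {n} σ = Σ (Formula Sg full (rank n)) λ φ → Σ Naming λ V →
    let p̄ = Naming.vs V is in
    (_ , _ , σ) ∉ conns φ
    × All (_∈ varsᴱs p̄) (freeObj φ)
    × (∀ (I : Structure Sg) → I ⊨∀ᴾ S → I ⊨∀ ∀* (rank n) (atom (ν n (app σ p̄) x̄) ⇔′ φ))

  record IsSemanticSpec (S : Pred (Sentence Sg) 0ℓ) : Set₁ where
    field
      hasEqAxioms : HasEqAxioms S
      defines     : ∀ {is n} (σ : Conn is (suc n)) → Defines S σ

  _IsSpecOf_ : ∀ {ℓ} → Pred (Sentence Sg) 0ℓ → Pred Concept ℓ → Set (lsuc 0ℓ ⊔ ℓ)
  S IsSpecOf L = ∀ C → L C ⇔ (∀ (I : Structure Sg) → I ⊨∀ᴾ S → ∀ a → I ⊩ a ∶ C)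

  ξ₊ ξ₋ : (n : Fin (suc M)) → Expr (suc n) → Formula Sg lopen (rank n) → Sentence Sg
  ξ₊ n E φ = ∀* (rank n) (atom (ν n E x̄) ⇒′ φ)
  ξ₋ n E φ = ∀* (rank n) (φ ⇒′ atom (ν n E x̄))

  record Normalised (S : Pred (Sentence Sg) 0ℓ) : Set₁ where
    field
      S⁺ S⁻ Sᵇ    : Pred (Sentence Sg) 0ℓ
      union       : S ≐ S⁺ ∪ S⁻ ∪ Sᵇ
      disjoint⁺⁻  : Empty (S⁺ ∩ S⁻)
      disjoint⁺ᵇ  : Empty (S⁺ ∩ Sᵇ)
      disjoint⁻ᵇ  : Empty (S⁻ ∩ Sᵇ)
      form⁺       : ∀ {χ} → S⁺ χ → ∃[ n ] ∃[ E ] ∃[ φ ] χ ≡ ξ₊ n E φ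
      form⁻       : ∀ {χ} → S⁻ χ → ∃[ n ] ∃[ E ] ∃[ φ ] χ ≡ ξ₋ n E φ
      unique⁺     : ∀ {n E φ φ′} → S⁺ (ξ₊ n E φ) → S⁺ (ξ₊ n E φ′) → φ ≡ φ′
      unique⁻     : ∀ {n E φ φ′} → S⁻ (ξ₋ n E φ) → S⁻ (ξ₋ n E φ′) → φ ≡ φ′
      atomicᵇ     : ∀ {χ} → Sᵇ χ → All (Atomic ∘ proj₂) (exprs χ)
      eqAxiomsᵇ   : HasEqAxioms Sᵇ

  data NNF : ℕ → Set where
    lit       : ∀ {k} → Literal Sg (Fin k) → NNF k
    ⊤ⁿ ⊥ⁿ     : ∀ {k} → NNF k
    _∧ⁿ_ _∨ⁿ_ : ∀ {k} → NNF k → NNF k → NNF k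
    ∀ⁿ ∃ⁿ     : ∀ {k} → NNF (suc k) → NNF k

  -- nnf true φ is a normal form of φ, nnf false φ one of ¬ φ.
  nnf : ∀ {k} → Bool → Formula Sg lopen k → NNF k
  nnf b     (atom A) = lit (signed b A)
  nnf true  ⊤′       = ⊤ⁿ
  nnf false ⊤′       = ⊥ⁿ
  nnf true  ⊥′       = ⊥ⁿ
  nnf false ⊥′       = ⊤ⁿ
  nnf true  (¬′ φ)   = nnf false φ
  nnf false (¬′ φ)   = nnf true φ
  nnf true  (φ ∧′ ψ) = nnf true φ ∧ⁿ nnf true ψ
  nnf false (φ ∧′ ψ) = nnf false φ ∨ⁿ nnf false ψ
  nnf true  (φ ∨′ ψ) = nnf true φ ∨ⁿ nnf true ψ
  nnf false (φ ∨′ ψ) = nnf false φ ∧ⁿ nnf false ψ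
  nnf true  (φ ⇒′ ψ) = nnf false φ ∨ⁿ nnf true ψ
  nnf false (φ ⇒′ ψ) = nnf true φ ∧ⁿ nnf false ψ
  nnf true  (∀′ φ)   = ∀ⁿ (nnf true φ)
  nnf false (∀′ φ)   = ∃ⁿ (nnf false φ)
  nnf true  (∃′ φ)   = ∃ⁿ (nnf true φ)
  nnf false (∃′ φ)   = ∀ⁿ (nnf false φ)

  -- Occurrences of existential quantifiers.
  data Ex : ∀ {k} → NNF k → Set where
    here : ∀ {k} {A : NNF (suc k)} → Ex (∃ⁿ A)
    in-∃ : ∀ {k} {A : NNF (suc k)} → Ex A → Ex (∃ⁿ A)
    in-∀ : ∀ {k} {A : NNF (suc k)} → Ex A → Ex (∀ⁿ A)
    ∧ˡ   : ∀ {k} {A B : NNF k} → Ex A → Ex (A ∧ⁿ B)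
    ∧ʳ   : ∀ {k} {A B : NNF k} → Ex B → Ex (A ∧ⁿ B)
    ∨ˡ   : ∀ {k} {A B : NNF k} → Ex A → Ex (A ∨ⁿ B)
    ∨ʳ   : ∀ {k} {A B : NNF k} → Ex B → Ex (A ∨ⁿ B)

  -- The number of universal quantifiers above an occurrence.
  depth : ∀ {k} {A : NNF k} → Ex A → ℕ
  depth here     = 0
  depth (in-∃ e) = depth e
  depth (in-∀ e) = suc (depth e)
  depth (∧ˡ e)   = depth e
  depth (∧ʳ e)   = depth e
  depth (∨ˡ e)   = depth e
  depth (∨ʳ e)   = depth e

  #∀ : ∀ {k} → NNF k → ℕ
  #∀ (lit l)  = 0
  #∀ ⊤ⁿ       = 0
  #∀ ⊥ⁿ       = 0
  #∀ (A ∧ⁿ B) = #∀ A + #∀ B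
  #∀ (A ∨ⁿ B) = #∀ A + #∀ B
  #∀ (∀ⁿ A)   = suc (#∀ A)
  #∀ (∃ⁿ A)   = #∀ A

  -- What gets Skolemised: φ for a sentence ξ₊ n E φ, ¬ φ for a sentence
  -- ξ₋ n E φ (whose contrapositive is used), or a background sentence.
  data Source : Set where
    plus minus : (n : Fin (suc M)) → Expr (suc n) → Formula Sg lopen (rank n) → Source
    back       : Sentence Sg → Source

  -- The number of leading universal quantifiers x̄ outside the matrix.
  scope : Source → ℕ
  scope (plus n E φ)  = rank n
  scope (minus n E φ) = rank n
  scope (back χ)      = 0

  matrix : (o : Source) → NNF (scope o)
  matrix (plus n E φ)  = nnf true φ
  matrix (minus n E φ) = nnf false φ
  matrix (back χ)      = nnf true χ

  objVars : Source → List ObjVar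
  objVars (plus n E φ)  = deduplicate _≟ᵒ_ (freeObj (ξ₊ n E φ))
  objVars (minus n E φ) = deduplicate _≟ᵒ_ (freeObj (ξ₋ n E φ))
  objVars (back χ)      = deduplicate _≟ᵒ_ (freeObj χ)

  -- One Skolem function for each existential quantifier; it depends on
  -- the object variables of the sentence and the universally quantified domain
  -- variables whose scope contains it.  `input` is the fresh domain constant
  -- of the root of tableaux.
  data Fun⁺ : Set where
    base   : Fun → Fun⁺
    skolem : (o : Source) → Ex (matrix o) → Fun⁺
    input  : Fun⁺

  Sg⁺ : Signature 𝓛
  Sg⁺ = record
    { Fun     = Fun⁺
    ; objArgs = λ { (base f)     → Signature.objArgs Sg f
                  ; (skolem o e) → map proj₁ (objVars o)
                  ; input        → [] }
    ; arity   = λ { (base f)     → Signature.arity Sg f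
                  ; (skolem o e) → scope o + depth e
                  ; input        → 0 }
    ; Prd     = Signature.Prd Sg
    ; parity  = Signature.parity Sg
    }

  liftᵀ  : ∀ {X} → Term Sg X → Term Sg⁺ X
  liftᵀs : ∀ {X n} → Vec (Term Sg X) n → Vec (Term Sg⁺ X) n
  liftᵀ (var x)       = var x
  liftᵀ (ν₀ E)        = ν₀ E
  liftᵀ (fun f Es ts) = fun (base f) Es (liftᵀs ts)
  liftᵀs []           = []
  liftᵀs (t ∷ ts)     = liftᵀ t ∷ liftᵀs ts

  liftᴬ : ∀ {X} → Atom Sg X → Atom Sg⁺ X
  liftᴬ (ν n E ts)         = ν n E (liftᵀs ts)
  liftᴬ (pred ≈ᵈ ts)       = pred ≈ᵈ (liftᵀs ts)
  liftᴬ (pred (prd P) ts)  = pred (prd P) (liftᵀs ts)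
  liftᴬ (E ≈ᵒ G)           = E ≈ᵒ G

  liftᴸ : ∀ {X} → Literal Sg X → Literal Sg⁺ X
  liftᴸ (pos A) = pos (liftᴬ A)
  liftᴸ (neg A) = neg (liftᴬ A)

  -- The domain variables of rules are named by natural numbers.
  RTerm RLit : Set
  RTerm = Term Sg⁺ ℕ
  RLit  = Literal Sg⁺ ℕ

  DNF : Set
  DNF = List (List RLit)

  -- Skolemisation followed by distribution of ∧ over ∨.  `env` gives the terms
  -- for the variables in scope, `sk` the Skolem term for an existential
  -- quantifier applied to the variables for the universal quantifiers above
  -- it in A, and `next` is the first unused variable.
  clauses : ∀ {k} (A : NNF k) → Vec RTerm k →
            ((e : Ex A) → Vec RTerm (depth e) → RTerm) → ℕ → DNF
  clauses (lit l)  env sk next = [ [ liftᴸ l [ (λ i → var) , Vec.lookup env ]ᴸ ] ]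
  clauses ⊤ⁿ       env sk next = [ [] ]
  clauses ⊥ⁿ       env sk next = []
  clauses (A ∧ⁿ B) env sk next = cartesianProductWith _++_
    (clauses A env (sk ∘ ∧ˡ) next) (clauses B env (sk ∘ ∧ʳ) (next + #∀ A))
  clauses (A ∨ⁿ B) env sk next =
    clauses A env (sk ∘ ∨ˡ) next ++ clauses B env (sk ∘ ∨ʳ) (next + #∀ A)
  clauses (∀ⁿ A)   env sk next =
    clauses A (var next ∷ env) (λ e ts → sk (in-∀ e) (var next ∷ ts)) (suc next)
  clauses (∃ⁿ A)   env sk next =
    clauses A (sk here [] ∷ env) (sk ∘ in-∃) next

  xs : ∀ {k} → Vec RTerm k
  xs = tabulate (var ∘ toℕ)

  dnf : Source → DNF
  dnf o = clauses (matrix o) xs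
    (λ e ts → fun (skolem o e) (varsFrom (objVars o)) (xs Vec.++ ts))
    (scope o)

  -- An empty list of denominators stands for ⊥.  A single side of a generated
  -- rule is empty only in degenerate cases: a background sentence whose normal
  -- form has no variables, a disjunct ⊤ of a normal form, and the reflexivity
  -- rule of a predicate symbol without arguments.
  record Rule : Set where
    constructor _/_
    field
      premises     : List RLit
      denominators : List (List RLit)

  domRefl : ℕ → RLit
  domRefl x = pos (var x ≐ᵈ var x)

  objRefl : ObjVar → RLit
  objRefl (i , j) = pos (_≈ᵒ_ {i = i} (var j) (var j))

  domVarsᴰ : DNF → List ℕ
  domVarsᴰ D = deduplicate ℕ._≟_ (concatMap (domVarsᴬ ∘ atomOf) (concat D))

  objVarsᴰ : DNF → List ObjVar
  objVarsᴰ D = deduplicate _≟ᵒ_ (concatMap (varsᴬ ∘ atomOf) (concat D))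

  -- The premises yᵢ ≈ yᵢ for the free variables of D that do not occur in the
  -- main premise ν_n(E , x̄), that is, other than x̄ and the variables of E.
  sidePremises : ∀ {i} → ℕ → Expr i → DNF → List RLit
  sidePremises k E D =
    map domRefl (filter (k ≤?_) (domVarsᴰ D)) ++
    map objRefl (filter (λ w → ¬? (w ∈? varsᴱ E)) (objVarsᴰ D))
    where open import Data.List.Membership.DecPropositional _≟ᵒ_ using (_∈?_)

  open Naming canonical

  -- The schematic literals (¬)A for the predicate symbols A, over the object
  -- variables v j and the domain variables xs, and the corresponding
  -- reflexivity literals.
  data SymbolAtom : Atom Sg⁺ ℕ → List RLit → Set where
    νˢ    : ∀ n → SymbolAtom (ν n (v 0) xs) (objRefl (suc n , 0) ∷ Vec.toList (Vec.map (λ t → pos (t ≐ᵈ t)) (xs {rank n})))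
    predˢ : ∀ P → SymbolAtom (pred P xs) (Vec.toList (Vec.map (λ t → pos (t ≐ᵈ t)) (xs {par P})))
    ≈ᵒˢ   : ∀ i → SymbolAtom (_≈ᵒ_ {i = i} (v 0) (v 1)) (objRefl (i , 0) ∷ objRefl (i , 1) ∷ [])

  -- A domain variable different from the k variables xs.
  y : ∀ k → RTerm
  y k = var k

  module _ {S : Pred (Sentence Sg) 0ℓ} (N : Normalised S) where
    open Normalised N

    data T : Pred Rule 0ℓ where
      plus-rule : ∀ {n E φ} → S⁺ (ξ₊ n E φ) → let D = dnf (plus n E φ) in
        T ((pos (ν n E xs) ∷ sidePremises (rank n) E D) / D)
      minus-rule : ∀ {n E φ} → S⁻ (ξ₋ n E φ) → let D = dnf (minus n E φ) in
        T ((neg (ν n E xs) ∷ sidePremises (rank n) E D) / D)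
      back-rule : ∀ {χ} → Sᵇ χ → ¬ IsEqAxiom χ → let D = dnf (back χ) in
        T ((map objRefl (objVarsᴰ D) ++ map domRefl (domVarsᴰ D)) / D)
      refl-rule : ∀ {A R} b → SymbolAtom A R → T ([ signed b A ] / [ R ])
      symᵈ-rule : T ([ pos (var 0 ≐ᵈ var 1) ] / [ [ pos (var 1 ≐ᵈ var 0) ] ])
      symᵒ-rule : ∀ i → T ([ pos (v {i} 0 ≈ᵒ v 1) ] / [ [ pos (v {i} 1 ≈ᵒ v 0) ] ])
      transᵈ-rule :
        T ((pos (var 0 ≐ᵈ var 1) ∷ pos (var 1 ≐ᵈ var 2) ∷ []) / [ [ pos (var 0 ≐ᵈ var 2) ] ])
      transᵒ-rule : ∀ i →
        T ((pos (v {i} 0 ≈ᵒ v 1) ∷ pos (v {i} 1 ≈ᵒ v 2) ∷ []) / [ [ pos (v {i} 0 ≈ᵒ v 2) ] ])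
      congᴾ-rule : ∀ P (i : Fin (par P)) →
        T ((pos (pred P xs) ∷ pos (Vec.lookup xs i ≐ᵈ y (par P)) ∷ [])
           / [ [ pos (pred P (xs [ i ]≔ y (par P))) ] ])
      cong-≈ᵒˡ-rule : ∀ i →
        T ((pos (v {i} 0 ≈ᵒ v 1) ∷ pos (v {i} 0 ≈ᵒ v 2) ∷ []) / [ [ pos (v {i} 2 ≈ᵒ v 1) ] ])
      -- (the same rule as transᵒ-rule)
      cong-≈ᵒʳ-rule : ∀ i →
        T ((pos (v {i} 0 ≈ᵒ v 1) ∷ pos (v {i} 1 ≈ᵒ v 2) ∷ []) / [ [ pos (v {i} 0 ≈ᵒ v 2) ] ])
      congν-rule : ∀ n (i : Fin (rank n)) →
        T ((pos (ν n (v 0) xs) ∷ pos (Vec.lookup xs i ≐ᵈ y (rank n)) ∷ [])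
           / [ [ pos (ν n (v 0) (xs [ i ]≔ y (rank n))) ] ])
      congᶠ-rule : ∀ f (i : Fin (Signature.arity Sg⁺ f)) →
        let p̄ = vs (Signature.objArgs Sg⁺ f)
            z = y (Signature.arity Sg⁺ f) in
        T ((pos (fun f p̄ xs ≐ᵈ fun f p̄ xs) ∷ pos (Vec.lookup xs i ≐ᵈ z) ∷ [])
           / [ [ pos (fun f p̄ xs ≐ᵈ fun f p̄ (xs [ i ]≔ z)) ] ])
      closure-rule : ∀ {A R} → SymbolAtom A R → T ((pos A ∷ neg A ∷ []) / [])

  -- Literals without domain variables.  Their object variables denote
  -- themselves.
  GLit : Set
  GLit = Literal Sg⁺ ⊥

  record Application : Set where
    field
      rule : Rule
      objs : Subst
      doms : ℕ → Term Sg⁺ ⊥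

    inst : List RLit → List GLit
    inst = map _[ objs , doms ]ᴸ

    premises : List GLit
    premises = inst (Rule.premises rule)

    denominators : List (List GLit)
    denominators = map inst (Rule.denominators rule)

  _∼_ : Rel Application 0ℓ
  a ∼ b = Application.rule a ≡ Application.rule b × Application.premises a ≡ Application.premises b

  IsClosure : Pred Application 0ℓ
  IsClosure a = Rule.denominators (Application.rule a) ≡ []

  -- A node is given by the path from the root to it, last step first; j ∷ α is
  -- the j-th successor of α.
  Address : Set
  Address = List ℕ

  _≼_ : Rel Address 0ℓ
  α ≼ β = ∃[ γ ] β ≡ γ ++ α

  -- `step α` is the rule application that creates the successors of the node
  -- α, if any; it is irrelevant for α that are not nodes.
  module Tree (Γ : Pred GLit 0ℓ) (step : Address → Maybe Application) where

    data Node : Pred Address 0ℓ where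
      root  : Node []
      child : ∀ {α a} → Node α → step α ≡ just a →
              (j : Fin (length (Application.denominators a))) → Node (toℕ j ∷ α)

    added : Maybe Application → ℕ → Pred GLit 0ℓ
    added nothing  j l = ⊥
    added (just a) j l = Σ (Fin (length (Application.denominators a))) λ i →
      toℕ i ≡ j × l ∈ lookup (Application.denominators a) i

    label : Address → Pred GLit 0ℓ
    label []      = Γ
    label (j ∷ α) = label α ∪ added (step α) j

  module _ (rules : Pred Rule 0ℓ) where

    record Tableau (Γ : Pred GLit 0ℓ) : Set where
      field
        step : Address → Maybe Application

      open Tree Γ step public

      Applicable : Application → Address → Set
      Applicable a α = rules (Application.rule a) × All (label α) (Application.premises a)

      field
        applicable : ∀ {α a} → Node α → step α ≡ just a → Applicable a α
        once       : ∀ {α β a b} → Node β → α ≼ β → α ≢ β →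
                     step α ≡ just a → step β ≡ just b → ¬ a ∼ b

    module _ {Γ : Pred GLit 0ℓ} (t : Tableau Γ) where
      open Tableau t

      record IsPath (B : Pred Address 0ℓ) : Set where
        field
          nodes    : ∀ {α} → B α → Node α
          fromRoot : ∀ {j α} → B (j ∷ α) → B α
          linear   : ∀ {α β} → B α → B β → α ≼ β ⊎ β ≼ α

      IsBranch : Pred Address 0ℓ → Set₁
      IsBranch B = IsPath B × (∀ B′ → IsPath B′ → B ⊆ B′ → B′ ⊆ B)

      ClosedBranch : Pred Address 0ℓ → Set
      ClosedBranch B = ∃[ α ] B α × ∃[ a ] step α ≡ just a × IsClosure a

      AppliedOn : Pred Address 0ℓ → Application → Set
      AppliedOn B a = ∃[ α ] B α × ∃[ b ] step α ≡ just b × a ∼ b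

      -- A closure rule creates no successors, so that nothing else can be
      -- applied below it: only open branches need to be saturated.
      Finished : Set₁
      Finished = ∀ B → IsBranch B → ¬ ClosedBranch B →
        ∀ {α} a → B α → Applicable a α → AppliedOn B a

      Closed Open : Set₁
      Closed = ∀ B → IsBranch B → ClosedBranch B
      Open   = ¬ Closed

  inputSet : Pred Concept 0ℓ → Pred GLit 0ℓ
  inputSet 𝒮 l = ∃[ C ] 𝒮 C × l ≡ pos (ν zero C (fun input [] [] ∷ []))

  Satisfiable : Structure Sg → Pred Concept 0ℓ → Set
  Satisfiable I 𝒮 = ∃[ a ] (∀ {C} → 𝒮 C → I ⊩ a ∶ C)

-- A model I of the specification is expanded to the Skolem functions so that
-- each rule leads from true premises to a true denominator, for all valuations.
-- As ≈ need not be the identity in I, while the calculus has congruence rules for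
-- Skolem functions, these first replace their arguments by chosen representatives
-- of the ≈-classes; since I satisfies the congruence axioms, literals do not notice
-- the difference.  Following true denominators from the root then gives a branch
-- whose nodes are all true in the expanded model, and which therefore is not closed.

module Submission where

open import Defs
open import Level using (0ℓ)
open import Axiom.ExcludedMiddle using (ExcludedMiddle)
open import Data.Bool using (true; false)
open import Data.Empty using (⊥; ⊥-elim)
open import Data.Fin as Fin using (Fin; zero; suc; toℕ)
open import Data.Fin.Properties using (toℕ-injective)
open import Data.List using (List; []; _∷_; _++_; map; concatMap; length; initLast; _∷ʳ′_)
open import Data.List.Membership.Propositional using (_∈_)
open import Data.List.Membership.Propositional.Properties using (∈-deduplicate⁺)
open import Data.List.Properties using (∷-injectiveʳ; ++-identityʳ; ++-assoc; length-++)
open import Data.List.Relation.Unary.All as All using (All; []; _∷_)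
import Data.List.Relation.Unary.All.Properties as All
open import Data.List.Relation.Unary.Any as Any using (Any; here)
import Data.List.Relation.Unary.Any.Properties as Any
open import Data.Maybe using (Maybe; just; nothing)
open import Data.Maybe.Properties using (just-injective)
open import Data.Nat as ℕ using (ℕ; zero; suc; _<_)
open import Data.Nat.Properties using (n<1+n; m<n⇒m<1+n; <⇒≢; m≢1+n+m; +-suc)
open import Data.Product using (∃; ∃-syntax; _×_; _,_; proj₁; proj₂)
open import Data.Sum using (_⊎_; inj₁; inj₂)
open import Data.Unit using (⊤)
open import Data.Vec as Vec using (Vec; []; _∷_; tabulate; _[_]≔_)
open import Data.Vec.Properties using (tabulate∘lookup; map-[]≔; map-++; lookup-map; []≔-lookup)
open import Data.Vec.Relation.Binary.Pointwise.Inductive using (Pointwise; []; _∷_)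
open import Function using (_∘_; case_of_)
open import Relation.Binary using (IsEquivalence)
open import Relation.Binary.PropositionalEquality using (_≡_; _≢_; refl; sym; trans; cong; cong₂; subst; subst₂; module ≡-Reasoning)
open import Relation.Nullary using (¬_; yes; no; contradiction)
open import Relation.Unary using (Pred; _⊆_)

-- Splitting concatenated vectors, as needed for the arguments of Skolem functions.

module _ {A : Set} where

  take-++ : ∀ {m n} (as : Vec A m) (bs : Vec A n) → Vec.take m (as Vec.++ bs) ≡ as
  take-++ []       bs = refl
  take-++ (a ∷ as) bs = cong (a ∷_) (take-++ as bs)

  drop-++ : ∀ {m n} (as : Vec A m) (bs : Vec A n) → Vec.drop m (as Vec.++ bs) ≡ bs
  drop-++ []       bs = refl
  drop-++ (a ∷ as) bs = drop-++ as bs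

-- Substitutions into object expressions.

module Substitution (𝓛 : Language) where
  open Object 𝓛

  Agree : Subst → Subst → Pred ObjVar 0ℓ
  Agree s s′ (i , j) = s i j ≡ s′ i j

  Same : Subst → Subst → Pred (∃ Expr) 0ℓ
  Same s s′ (i , E) = E [ s ]ᴱ ≡ E [ s′ ]ᴱ

  module _ {s s′ : Subst} where

    []ᴱ-cong  : ∀ {i} (E : Expr i) → All (Agree s s′) (varsᴱ E) → E [ s ]ᴱ ≡ E [ s′ ]ᴱ
    []ᴱs-cong : ∀ {is} (Es : All Expr is) → All (Agree s s′) (varsᴱs Es) → Es [ s ]ᴱs ≡ Es [ s′ ]ᴱs
    []ᴱ-cong (var j)    (e ∷ []) = e
    []ᴱ-cong (con q)    _        = refl
    []ᴱ-cong (app σ Es) es       = cong (app σ) ([]ᴱs-cong Es es)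
    []ᴱs-cong []        _        = refl
    []ᴱs-cong (E ∷ Es)  es       =
      let p , q = All.++⁻ (varsᴱ E) es in cong₂ _∷_ ([]ᴱ-cong E p) ([]ᴱs-cong Es q)

    Agree⇒Same : ∀ Es → All (Agree s s′) (concatMap (varsᴱ ∘ proj₂) Es) → All (Same s s′) Es
    Agree⇒Same Es h = All.map (λ {(_ , E)} → []ᴱ-cong E) (All.map⁻ (All.concat⁻ h))

    Same-reduce : ∀ {is} (Es : All Expr is) →
      All (Same s s′) (All.reduce (_ ,_) Es) → Es [ s ]ᴱs ≡ Es [ s′ ]ᴱs
    Same-reduce []       []       = refl
    Same-reduce (E ∷ Es) (e ∷ es) = cong₂ _∷_ e (Same-reduce Es es)

  []ᴱ-identity  : ∀ {i} (E : Expr i) → E [ (λ _ → var) ]ᴱ ≡ E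
  []ᴱs-identity : ∀ {is} (Es : All Expr is) → Es [ (λ _ → var) ]ᴱs ≡ Es
  []ᴱ-identity (var j)    = refl
  []ᴱ-identity (con q)    = refl
  []ᴱ-identity (app σ Es) = cong (app σ) ([]ᴱs-identity Es)
  []ᴱs-identity []        = refl
  []ᴱs-identity (E ∷ Es)  = cong₂ _∷_ ([]ᴱ-identity E) ([]ᴱs-identity Es)

  module _ {s s′ s″ : Subst} (h : ∀ i j → s i j [ s′ ]ᴱ ≡ s″ i j) where

    -- The composite `s″` is given only up to the pointwise equality `h`, so that an identity on
    -- either side is covered without function extensionality.
    []ᴱ-∘  : ∀ {i} (E : Expr i) → E [ s ]ᴱ [ s′ ]ᴱ ≡ E [ s″ ]ᴱ
    []ᴱs-∘ : ∀ {is} (Es : All Expr is) → Es [ s ]ᴱs [ s′ ]ᴱs ≡ Es [ s″ ]ᴱs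
    []ᴱ-∘ (var j)    = h _ j
    []ᴱ-∘ (con q)    = refl
    []ᴱ-∘ (app σ Es) = cong (app σ) ([]ᴱs-∘ Es)
    []ᴱs-∘ []        = refl
    []ᴱs-∘ (E ∷ Es)  = cong₂ _∷_ ([]ᴱ-∘ E) ([]ᴱs-∘ Es)

  ↦-same : ∀ (s : Subst) {i} w (E : Expr i) → (s [ w ↦ E ]) i w ≡ E
  ↦-same s {i} w E with i Fin.≟ i | w ℕ.≟ w
  ... | yes refl | yes refl = refl
  ... | yes refl | no w≢w   = contradiction refl w≢w
  ... | no i≢i   | _        = contradiction refl i≢i

  ↦-other : ∀ (s : Subst) {i} w (E : Expr i) {j u} → (i , w) ≢ (j , u) → (s [ w ↦ E ]) j u ≡ s j u
  ↦-other s {i} w E {j} {u} ≢ with i Fin.≟ j | w ℕ.≟ u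
  ... | yes refl | yes refl = contradiction refl ≢
  ... | yes refl | no _     = refl
  ... | no _     | _        = refl

  module _ (V : Naming) where
    open Naming V

    -- The counter grows at every entry, whatever its sort, so an index below `k` never recurs;
    -- within one sort distinct indices have distinct names.
    vsFrom-↦ : ∀ (s : Subst) {i} (E : Expr i) {j k} → j < k → ∀ is →
      vsFrom k is [ s [ name i j ↦ E ] ]ᴱs ≡ vsFrom k is [ s ]ᴱs
    vsFrom-↦ s E j<k []        = refl
    vsFrom-↦ s {i} E {j} {k} j<k (i′ ∷ is) = cong₂ _∷_
      (↦-other s (name i j) E (<⇒≢ j<k ∘ index-≡))
      (vsFrom-↦ s E (m<n⇒m<1+n j<k) is)
      where
      index-≡ : (i , name i j) ≡ (i′ , name i′ k) → j ≡ k
      index-≡ e with cong proj₁ e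
      ... | refl = distinct i (cong proj₂ e)

    vsFrom-surjective : ∀ k {is} (Es : All Expr is) → ∃[ s ] vsFrom k is [ s ]ᴱs ≡ Es
    vsFrom-surjective k []                = (λ _ → var) , refl
    vsFrom-surjective k {i ∷ is} (E ∷ Es) =
      let s , e = vsFrom-surjective (suc k) Es in
      s [ name i k ↦ E ] , cong₂ _∷_ (↦-same s (name i k) E) (trans (vsFrom-↦ s E (n<1+n k) is) e)

  assign : ∀ (ws : List ObjVar) → All Expr (map proj₁ ws) → Subst
  assign []             []       = λ _ → var
  assign ((i , w) ∷ ws) (E ∷ Es) = assign ws Es [ w ↦ E ]

  -- A Skolem function receives only the values of the listed variables; this is how it recovers the
  -- valuation on them.
  assign-varsFrom : ∀ {s : Subst} (ws : List ObjVar) {i j} → (i , j) ∈ ws →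
    assign ws (varsFrom ws [ s ]ᴱs) i j ≡ s i j
  assign-varsFrom {s} (w′ ∷ ws) {i} {j} w∈ with w′ ≟ᵒ (i , j)
  ... | yes refl = ↦-same (assign ws (varsFrom ws [ s ]ᴱs)) j (s i j)
  ... | no ≢     = trans
    (↦-other (assign ws (varsFrom ws [ s ]ᴱs)) (proj₂ w′) (s _ _) ≢)
    (assign-varsFrom ws (Any.tail (≢ ∘ sym) w∈))

-- Evaluation in a structure and the substitution lemma.

module Evaluation {𝓛 : Language} {Sg : Signature 𝓛} (I : FO.Structure {𝓛} Sg) where
  open Object 𝓛
  open FO {𝓛}
  open Structure I hiding (Δ)
  open Substitution 𝓛

  ⟦_⟧ᴸ : ∀ {X} → Literal Sg X → Subst → (X → Δ I) → Set
  ⟦ pos A ⟧ᴸ s ρ = ⟦ A ⟧ᴬ s ρ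
  ⟦ neg A ⟧ᴸ s ρ = ¬ ⟦ A ⟧ᴬ s ρ

  module _ {X : Set} {s : Subst} {ρ : X → Δ I} where

    ⟦tabulate⟧ : ∀ {n} (f : Fin n → Term Sg X) →
      ⟦ tabulate f ⟧ᵀs s ρ ≡ tabulate (λ i → ⟦ f i ⟧ᵀ s ρ)
    ⟦tabulate⟧ {zero}  f = refl
    ⟦tabulate⟧ {suc n} f = cong₂ _∷_ refl (⟦tabulate⟧ (f ∘ suc))

    ⟦lookup⟧ : ∀ {n} (ts : Vec (Term Sg X) n) i →
      ⟦ Vec.lookup ts i ⟧ᵀ s ρ ≡ Vec.lookup (⟦ ts ⟧ᵀs s ρ) i
    ⟦lookup⟧ (t ∷ ts) zero    = refl
    ⟦lookup⟧ (t ∷ ts) (suc i) = ⟦lookup⟧ ts i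

    ⟦[]≔⟧ : ∀ {n} (ts : Vec (Term Sg X) n) i t →
      ⟦ ts [ i ]≔ t ⟧ᵀs s ρ ≡ ⟦ ts ⟧ᵀs s ρ [ i ]≔ ⟦ t ⟧ᵀ s ρ
    ⟦[]≔⟧ (t′ ∷ ts) zero    t = refl
    ⟦[]≔⟧ (t′ ∷ ts) (suc i) t = cong₂ _∷_ refl (⟦[]≔⟧ ts i t)

    ⟦++⟧ : ∀ {m n} (ts : Vec (Term Sg X) m) (us : Vec (Term Sg X) n) →
      ⟦ ts Vec.++ us ⟧ᵀs s ρ ≡ ⟦ ts ⟧ᵀs s ρ Vec.++ ⟦ us ⟧ᵀs s ρ
    ⟦++⟧ []       us = refl
    ⟦++⟧ (t ∷ ts) us = cong₂ _∷_ refl (⟦++⟧ ts us)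

  ⟦x̄⟧ : ∀ {k s} (ρ : Vec (Δ I) k) → ⟦ x̄ ⟧ᵀs s (Vec.lookup ρ) ≡ ρ
  ⟦x̄⟧ ρ = trans (⟦tabulate⟧ var) (tabulate∘lookup ρ)

  module _ {X Y : Set} {s s′ s″ : Subst} {τ : X → Term Sg Y} {ρ : Y → Δ I} {ρ′ : X → Δ I}
           (hs : ∀ i j → s i j [ s′ ]ᴱ ≡ s″ i j) (hτ : ∀ x → ⟦ τ x ⟧ᵀ s′ ρ ≡ ρ′ x) where

    ⟦[]⟧ᵀ  : ∀ t → ⟦ t [ s , τ ]ᵀ ⟧ᵀ s′ ρ ≡ ⟦ t ⟧ᵀ s″ ρ′
    ⟦[]⟧ᵀs : ∀ {n} (ts : Vec (Term Sg X) n) → ⟦ ts [ s , τ ]ᵀs ⟧ᵀs s′ ρ ≡ ⟦ ts ⟧ᵀs s″ ρ′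
    ⟦[]⟧ᵀ (var x)       = hτ x
    ⟦[]⟧ᵀ (ν₀ E)        = cong ν₀ᴵ ([]ᴱ-∘ hs E)
    ⟦[]⟧ᵀ (fun f Es ts) = cong₂ (funᴵ f) ([]ᴱs-∘ hs Es) (⟦[]⟧ᵀs ts)
    ⟦[]⟧ᵀs []           = refl
    ⟦[]⟧ᵀs (t ∷ ts)     = cong₂ _∷_ (⟦[]⟧ᵀ t) (⟦[]⟧ᵀs ts)

    ⟦[]⟧ᴬ : ∀ A → ⟦ A [ s , τ ]ᴬ ⟧ᴬ s′ ρ ≡ ⟦ A ⟧ᴬ s″ ρ′
    ⟦[]⟧ᴬ (ν n E ts)  = cong₂ (νᴵ n) ([]ᴱ-∘ hs E) (⟦[]⟧ᵀs ts)
    ⟦[]⟧ᴬ (pred P ts) = cong (predᴵ P) (⟦[]⟧ᵀs ts)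
    ⟦[]⟧ᴬ (E ≈ᵒ F)    = cong₂ (eqᴵ _) ([]ᴱ-∘ hs E) ([]ᴱ-∘ hs F)

    ⟦[]⟧ᴸ : ∀ l → ⟦ l [ s , τ ]ᴸ ⟧ᴸ s′ ρ ≡ ⟦ l ⟧ᴸ s″ ρ′
    ⟦[]⟧ᴸ (pos A) = ⟦[]⟧ᴬ A
    ⟦[]⟧ᴸ (neg A) = cong ¬_ (⟦[]⟧ᴬ A)

  ∀*-elim : ∀ {κ} k {φ : Formula Sg κ k} {s} → ⟦ ∀* k φ ⟧ s [] → ∀ ρ → ⟦ φ ⟧ s ρ
  ∀*-elim zero    h []      = h
  -- Variable `zero` is bound innermost, so the head of the vector is supplied last.
  ∀*-elim (suc k) h (d ∷ ρ) = ∀*-elim k h ρ d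

  -- Semantics of negation normal forms.

  open Calculus Sg using (NNF; nnf; lit; ⊤ⁿ; ⊥ⁿ; _∧ⁿ_; _∨ⁿ_; ∀ⁿ; ∃ⁿ)

  ⟦_⟧ⁿ : ∀ {k} → NNF k → Subst → Vec (Δ I) k → Set
  ⟦ lit l ⟧ⁿ s ρ  = ⟦ l ⟧ᴸ s (Vec.lookup ρ)
  ⟦ ⊤ⁿ ⟧ⁿ s ρ     = ⊤
  ⟦ ⊥ⁿ ⟧ⁿ s ρ     = ⊥
  ⟦ A ∧ⁿ B ⟧ⁿ s ρ = ⟦ A ⟧ⁿ s ρ × ⟦ B ⟧ⁿ s ρ
  ⟦ A ∨ⁿ B ⟧ⁿ s ρ = ⟦ A ⟧ⁿ s ρ ⊎ ⟦ B ⟧ⁿ s ρ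
  ⟦ ∀ⁿ A ⟧ⁿ s ρ   = ∀ d → ⟦ A ⟧ⁿ s (d ∷ ρ)
  ⟦ ∃ⁿ A ⟧ⁿ s ρ   = ∃[ d ] ⟦ A ⟧ⁿ s (d ∷ ρ)

  module _ (em : ExcludedMiddle 0ℓ) {s : Subst} where

    -- Mutual induction over both polarities. Excluded middle is used to choose a disjunct for an
    -- implication or a negated conjunction, to find a counterexample to a negated universal
    -- formula, and to recover a formula from its double negation or from a negated implication.
    nnf-true  : ∀ {k} (φ : Formula Sg lopen k) {ρ} → ⟦ φ ⟧ s ρ → ⟦ nnf true φ ⟧ⁿ s ρ
    nnf-false : ∀ {k} (φ : Formula Sg lopen k) {ρ} → ¬ ⟦ φ ⟧ s ρ → ⟦ nnf false φ ⟧ⁿ s ρ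
    nnf-true (atom A)  h        = h
    nnf-true ⊤′        h        = h
    nnf-true ⊥′        h        = h
    nnf-true (¬′ φ)    h        = nnf-false φ h
    nnf-true (φ ∧′ ψ)  (h , h′) = nnf-true φ h , nnf-true ψ h′
    nnf-true (φ ∨′ ψ)  (inj₁ h) = inj₁ (nnf-true φ h)
    nnf-true (φ ∨′ ψ)  (inj₂ h) = inj₂ (nnf-true ψ h)
    nnf-true (φ ⇒′ ψ) {ρ} h with em {P = ⟦ φ ⟧ s ρ}
    ... | yes p = inj₂ (nnf-true ψ (h p))
    ... | no ¬p = inj₁ (nnf-false φ ¬p)
    nnf-true (∀′ φ)    h        = λ d → nnf-true φ (h d)
    nnf-true (∃′ φ)    (d , h)  = d , nnf-true φ h
    nnf-false (atom A) h        = h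
    nnf-false ⊤′       h        = h _
    nnf-false ⊥′       h        = _
    nnf-false (¬′ φ) {ρ} h with em {P = ⟦ φ ⟧ s ρ}
    ... | yes p = nnf-true φ p
    ... | no ¬p = contradiction ¬p h
    nnf-false (φ ∧′ ψ) {ρ} h with em {P = ⟦ φ ⟧ s ρ}
    ... | yes p = inj₂ (nnf-false ψ λ q → h (p , q))
    ... | no ¬p = inj₁ (nnf-false φ ¬p)
    nnf-false (φ ∨′ ψ) h        = nnf-false φ (h ∘ inj₁) , nnf-false ψ (h ∘ inj₂)
    nnf-false (φ ⇒′ ψ) {ρ} h with em {P = ⟦ φ ⟧ s ρ}
    ... | yes p = nnf-true φ p , nnf-false ψ λ q → h λ _ → q
    ... | no ¬p = contradiction (λ p → contradiction p ¬p) h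
    nnf-false (∀′ φ) {ρ} h with em {P = ∃[ d ] ¬ ⟦ φ ⟧ s (d ∷ ρ)}
    ... | yes (d , ¬p) = d , nnf-false φ ¬p
    ... | no ¬∃        = contradiction
      (λ d → case em {P = ⟦ φ ⟧ s (d ∷ ρ)} of λ { (yes p) → p ; (no ¬p) → contradiction (d , ¬p) ¬∃ }) h
    nnf-false (∃′ φ)   h        = λ d → nnf-false φ λ p → h (d , p)

-- Consequences of the equality axioms in a model.

module Equality {𝓛 : Language} {Sg : Signature 𝓛} (I : FO.Structure {𝓛} Sg)
  {S : Pred (FO.Sentence {𝓛} Sg) 0ℓ} (hasEq : Calculus.HasEqAxioms Sg S) (I⊨S : FO._⊨∀ᴾ_ {𝓛} I S) where
  open Object 𝓛
  open FO {𝓛}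
  open Calculus Sg
  open Structure I hiding (Δ)
  open Substitution 𝓛
  open Evaluation I

  infix 4 _≈_
  _≈_ : Δ I → Δ I → Set
  d ≈ e = predᴵ ≈ᵈ (d ∷ e ∷ [])

  axiom : ∀ a s → ⟦ eqAxiom a (proj₁ (hasEq a)) ⟧ s []
  axiom a = I⊨S (proj₂ (hasEq a))

  -- The values E̅ for the object variables of an equality axiom are realised by a
  -- substitution because these variables are pairwise distinct.
  axiom-at : ∀ a {is} (Es : All Expr is) →
    ∃[ s ] Naming.vs (proj₁ (hasEq a)) is [ s ]ᴱs ≡ Es × ⟦ eqAxiom a (proj₁ (hasEq a)) ⟧ s []
  axiom-at a Es = let s , e = vsFrom-surjective (proj₁ (hasEq a)) 0 Es in s , e , axiom a s

  ≈-isEquivalence : IsEquivalence _≈_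
  ≈-isEquivalence = record
    { refl  = λ {d} → axiom reflᵈ (λ _ → var) d
    -- Values go in reverse order, as the outermost quantifier binds the highest index.
    ; sym   = λ {d} {e} → axiom symᵈ (λ _ → var) e d
    ; trans = λ {d} {e} {f} p q → axiom transᵈ (λ _ → var) f e d (p , q)
    }

  open IsEquivalence ≈-isEquivalence public
    renaming (refl to ≈-refl; sym to ≈-sym; trans to ≈-trans; reflexive to ≈-reflexive)

  eq-refl : ∀ {i} (E : Expr i) → eqᴵ i E E
  eq-refl {i} E with axiom-at (reflᵒ i) (E ∷ [])
  ... | s , refl , h = h

  eq-sym : ∀ {i} {E F : Expr i} → eqᴵ i E F → eqᴵ i F E
  eq-sym {i} {E} {F} p with axiom-at (symᵒ i) (E ∷ F ∷ [])
  ... | s , refl , h = h p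

  eq-trans : ∀ {i} {E F G : Expr i} → eqᴵ i E F → eqᴵ i F G → eqᴵ i E G
  eq-trans {i} {E} {F} {G} p q with axiom-at (transᵒ i) (E ∷ F ∷ G ∷ [])
  ... | s , refl , h = h (p , q)

  -- Turns an instance of a congruence axiom, whose schematic terms are still to be evaluated, into
  -- a statement about the values. Abstracting over `Q` serves `ν`, predicates and functions alike.
  ⟦replace⟧ : ∀ {k s} (d : Δ I) (ds : Vec (Δ I) k) i (Q : Vec (Δ I) k → Δ I → Vec (Δ I) k → Set) →
    let us  = tabulate (λ j → var (suc j))
        val = Vec.lookup (d ∷ ds) in
    Q (⟦ us ⟧ᵀs s val) (⟦ Vec.lookup us i ⟧ᵀ s val) (⟦ us [ i ]≔ var zero ⟧ᵀs s val) →
    Q ds (Vec.lookup ds i) (ds [ i ]≔ d)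
  ⟦replace⟧ {s = s} d ds i Q q
    rewrite ⟦lookup⟧ {s = s} {Vec.lookup (d ∷ ds)} (tabulate (λ j → var (suc j))) i
          | ⟦[]≔⟧ {s = s} {Vec.lookup (d ∷ ds)} (tabulate (λ j → var (suc j))) i (var zero)
          | ⟦tabulate⟧ {s = s} {Vec.lookup (d ∷ ds)} (λ j → var (suc j))
          | tabulate∘lookup ds = q

  ν-replace : ∀ n {E ds} i {d} → νᴵ n E ds → Vec.lookup ds i ≈ d → νᴵ n E (ds [ i ]≔ d)
  ν-replace n {E} {ds} i {d} p q with axiom-at (congν n i) (E ∷ [])
  ... | s , refl , h = ⟦replace⟧ d ds i (λ us u us′ → νᴵ n E us × u ≈ d → νᴵ n E us′)
    (∀*-elim (suc (rank n)) {s = s} h (d ∷ ds)) (p , q)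

  prd-replace : ∀ P {ds} i {d} → predᴵ (prd P) ds → Vec.lookup ds i ≈ d → predᴵ (prd P) (ds [ i ]≔ d)
  prd-replace P {ds} i {d} p q =
    ⟦replace⟧ d ds i (λ us u us′ → predᴵ (prd P) us × u ≈ d → predᴵ (prd P) us′)
    (∀*-elim (suc (Signature.parity Sg P)) (axiom (congᴾ P i) λ _ → var) (d ∷ ds)) (p , q)

  pred-replace : ∀ P {ds} i {d} → predᴵ P ds → Vec.lookup ds i ≈ d → predᴵ P (ds [ i ]≔ d)
  pred-replace (prd P)         i          p q = prd-replace P i p q
  -- `EqAxiom` has no congruence axiom for `≈ᵈ`; symmetry and transitivity yield it.
  pred-replace ≈ᵈ {_ ∷ _ ∷ []} zero       p q = ≈-trans (≈-sym q) p
  pred-replace ≈ᵈ {_ ∷ _ ∷ []} (suc zero) p q = ≈-trans p q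

  fun-replace : ∀ f Es ds i {d} → Vec.lookup ds i ≈ d → funᴵ f Es ds ≈ funᴵ f Es (ds [ i ]≔ d)
  fun-replace f Es ds i {d} q with axiom-at (congᶠ f i) Es
  ... | s , refl , h = ⟦replace⟧ d ds i (λ us u us′ → u ≈ d → funᴵ f Es us ≈ funᴵ f Es us′)
    (∀*-elim (suc (Signature.arity Sg f)) {s = s} h (d ∷ ds)) q

  -- Arguments are exchanged one by one from the left; a replaced one is then frozen inside the
  -- property `Q ∘ (e ∷_)`.
  replace⇒cong : ∀ {n} (Q : Vec (Δ I) n → Set) →
    (∀ {ds} i {d} → Q ds → Vec.lookup ds i ≈ d → Q (ds [ i ]≔ d)) →
    ∀ {ds es} → Pointwise _≈_ ds es → Q ds → Q es
  replace⇒cong Q rep []              q = q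
  replace⇒cong Q rep (_∷_ {y = e} p ps) q =
    replace⇒cong (Q ∘ (e ∷_)) (λ i → rep (suc i)) ps (rep zero q p)

  fun-cong : ∀ f Es {ds es} → Pointwise _≈_ ds es → funᴵ f Es ds ≈ funᴵ f Es es
  fun-cong f Es {ds} ps = replace⇒cong (λ es → funᴵ f Es ds ≈ funᴵ f Es es)
    (λ {es} i p q → ≈-trans p (fun-replace f Es es i q)) ps ≈-refl

  module _ {X : Set} {s s′ : Subst} {ρ ρ′ : X → Δ I} (h : ∀ x → ρ x ≈ ρ′ x) where

    -- Domain values may vary up to `≈`, but expressions must stay identical: the congruence axioms
    -- concern domain arguments only.
    ⟦⟧ᵀ-cong  : ∀ t → All (Same s s′) (exprsᵀ t) → ⟦ t ⟧ᵀ s ρ ≈ ⟦ t ⟧ᵀ s′ ρ′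
    ⟦⟧ᵀs-cong : ∀ {n} (ts : Vec (Term Sg X) n) → All (Same s s′) (exprsᵀs ts) →
      Pointwise _≈_ (⟦ ts ⟧ᵀs s ρ) (⟦ ts ⟧ᵀs s′ ρ′)
    ⟦⟧ᵀ-cong (var x)       _        = h x
    ⟦⟧ᵀ-cong (ν₀ E)        (e ∷ []) = ≈-reflexive (cong ν₀ᴵ e)
    ⟦⟧ᵀ-cong (fun f Es ts) es       =
      let p , q = All.++⁻ (All.reduce (_ ,_) Es) es in
      ≈-trans (fun-cong f _ (⟦⟧ᵀs-cong ts q))
              (≈-reflexive (cong (λ Es → funᴵ f Es (⟦ ts ⟧ᵀs s′ ρ′)) (Same-reduce Es p)))
    ⟦⟧ᵀs-cong []           _        = []
    ⟦⟧ᵀs-cong (t ∷ ts)     es       =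
      let p , q = All.++⁻ (exprsᵀ t) es in ⟦⟧ᵀ-cong t p ∷ ⟦⟧ᵀs-cong ts q

    ⟦⟧ᴬ-cong : ∀ A → All (Same s s′) (exprsᴬ A) → ⟦ A ⟧ᴬ s ρ → ⟦ A ⟧ᴬ s′ ρ′
    ⟦⟧ᴬ-cong (ν n E ts) (e ∷ es) q =
      subst (λ E → νᴵ n E (⟦ ts ⟧ᵀs s′ ρ′)) e
        (replace⇒cong (νᴵ n (E [ s ]ᴱ)) (ν-replace n) (⟦⟧ᵀs-cong ts es) q)
    ⟦⟧ᴬ-cong (pred P ts) es q = replace⇒cong (predᴵ P) (pred-replace P) (⟦⟧ᵀs-cong ts es) q
    ⟦⟧ᴬ-cong (E ≈ᵒ F) (e ∷ f ∷ []) q = subst₂ (eqᴵ _) e f q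

  ⟦⟧ᴸ-cong : ∀ {X : Set} {s s′} {ρ ρ′ : X → Δ I} → (∀ x → ρ x ≈ ρ′ x) →
    ∀ l → All (Agree s s′) (varsᴬ (atomOf l)) → ⟦ l ⟧ᴸ s ρ → ⟦ l ⟧ᴸ s′ ρ′
  ⟦⟧ᴸ-cong h (pos A) a = ⟦⟧ᴬ-cong h A (Agree⇒Same (exprsᴬ A) a)
  ⟦⟧ᴸ-cong h (neg A) a = λ ¬p q →
    ¬p (⟦⟧ᴬ-cong (≈-sym ∘ h) A (All.map sym (Agree⇒Same (exprsᴬ A) a)) q)

-- Object variables of normal forms and of universal closures.

module _ {𝓛 : Language} {Sg : Signature 𝓛} where
  open Object 𝓛
  open FO {𝓛}
  open Calculus Sg

  objVarsⁿ : ∀ {k} → NNF k → List ObjVar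
  objVarsⁿ (lit l)  = varsᴬ (atomOf l)
  objVarsⁿ ⊤ⁿ       = []
  objVarsⁿ ⊥ⁿ       = []
  objVarsⁿ (A ∧ⁿ B) = objVarsⁿ A ++ objVarsⁿ B
  objVarsⁿ (A ∨ⁿ B) = objVarsⁿ A ++ objVarsⁿ B
  objVarsⁿ (∀ⁿ A)   = objVarsⁿ A
  objVarsⁿ (∃ⁿ A)   = objVarsⁿ A

  -- Either polarity keeps all atoms in their order, so the lists are even equal.
  objVarsⁿ-nnf : ∀ {k} b (φ : Formula Sg lopen k) → objVarsⁿ (nnf b φ) ≡ freeObj φ
  objVarsⁿ-nnf true  (atom A) = refl
  objVarsⁿ-nnf false (atom A) = refl
  objVarsⁿ-nnf true  ⊤′       = refl
  objVarsⁿ-nnf false ⊤′       = refl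
  objVarsⁿ-nnf true  ⊥′       = refl
  objVarsⁿ-nnf false ⊥′       = refl
  objVarsⁿ-nnf true  (¬′ φ)   = objVarsⁿ-nnf false φ
  objVarsⁿ-nnf false (¬′ φ)   = objVarsⁿ-nnf true φ
  objVarsⁿ-nnf true  (φ ∧′ ψ) = cong₂ _++_ (objVarsⁿ-nnf true φ) (objVarsⁿ-nnf true ψ)
  objVarsⁿ-nnf false (φ ∧′ ψ) = cong₂ _++_ (objVarsⁿ-nnf false φ) (objVarsⁿ-nnf false ψ)
  objVarsⁿ-nnf true  (φ ∨′ ψ) = cong₂ _++_ (objVarsⁿ-nnf true φ) (objVarsⁿ-nnf true ψ)
  objVarsⁿ-nnf false (φ ∨′ ψ) = cong₂ _++_ (objVarsⁿ-nnf false φ) (objVarsⁿ-nnf false ψ)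
  objVarsⁿ-nnf true  (φ ⇒′ ψ) = cong₂ _++_ (objVarsⁿ-nnf false φ) (objVarsⁿ-nnf true ψ)
  objVarsⁿ-nnf false (φ ⇒′ ψ) = cong₂ _++_ (objVarsⁿ-nnf true φ) (objVarsⁿ-nnf false ψ)
  objVarsⁿ-nnf true  (∀′ φ)   = objVarsⁿ-nnf true φ
  objVarsⁿ-nnf false (∀′ φ)   = objVarsⁿ-nnf false φ
  objVarsⁿ-nnf true  (∃′ φ)   = objVarsⁿ-nnf true φ
  objVarsⁿ-nnf false (∃′ φ)   = objVarsⁿ-nnf false φ

  freeObj-∀* : ∀ {κ} k {φ : Formula Sg κ k} → freeObj (∀* k φ) ≡ freeObj φ
  freeObj-∀* zero    = refl
  freeObj-∀* (suc k) = freeObj-∀* k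

-- Expansion of a model to the Skolem functions and the input constant.

module Expansion (em : ExcludedMiddle 0ℓ) (choice : Choice)
  {𝓛 : Language} {Sg : Signature 𝓛} (I : FO.Structure {𝓛} Sg)
  {S : Pred (FO.Sentence {𝓛} Sg) 0ℓ} (hasEq : Calculus.HasEqAxioms Sg S) (I⊨S : FO._⊨∀ᴾ_ {𝓛} I S)
  (a : FO.Δ {𝓛} I) where
  open Object 𝓛
  open FO {𝓛}
  open Calculus Sg
  open Structure I hiding (Δ)
  open Substitution 𝓛
  open Evaluation I
  open Equality I {S} hasEq I⊨S

  rep : Δ I → Δ I
  rep = proj₁ (choice _≈_ ≈-isEquivalence)

  rep-≈ : ∀ d → rep d ≈ d
  rep-≈ = proj₁ (proj₂ (choice _≈_ ≈-isEquivalence))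

  rep-cong : ∀ {d e} → d ≈ e → rep d ≡ rep e
  rep-cong = proj₂ (proj₂ (choice _≈_ ≈-isEquivalence))

  reps : ∀ {n} → Vec (Δ I) n → Vec (Δ I) n
  reps = Vec.map rep

  reps-≈ : ∀ {n} (ds : Vec (Δ I) n) → Pointwise _≈_ (reps ds) ds
  reps-≈ []       = []
  reps-≈ (d ∷ ds) = rep-≈ d ∷ reps-≈ ds

  ≈-reps : ∀ {n} (ds : Vec (Δ I) n) → Pointwise _≈_ ds (reps ds)
  ≈-reps []       = []
  ≈-reps (d ∷ ds) = ≈-sym (rep-≈ d) ∷ ≈-reps ds

  -- Hilbert's epsilon operator on the domain, with default value `nonempty`.
  choose : (Δ I → Set) → Δ I
  choose P with em {P = ∃ P}
  ... | yes (d , _) = d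
  ... | no _        = nonempty

  choose-satisfies : ∀ P → ∃ P → P (choose P)
  choose-satisfies P p with em {P = ∃ P}
  ... | yes (_ , q) = q
  ... | no ¬p       = contradiction p ¬p

  -- The value of an existential quantifier, given values for the universal
  -- quantifiers above it; those for the existential ones above it are
  -- recomputed, so that it depends on nothing else.
  witness : ∀ {k} (A : NNF k) → Subst → Vec (Δ I) k → (e : Ex A) → Vec (Δ I) (depth e) → Δ I
  witness (∃ⁿ A)   s ρ here     []       = choose λ d → ⟦ A ⟧ⁿ s (d ∷ ρ)
  witness (∃ⁿ A)   s ρ (in-∃ e) ds       = witness A s (choose (λ d → ⟦ A ⟧ⁿ s (d ∷ ρ)) ∷ ρ) e ds
  witness (∀ⁿ A)   s ρ (in-∀ e) (d ∷ ds) = witness A s (d ∷ ρ) e ds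
  witness (A ∧ⁿ B) s ρ (∧ˡ e)   ds       = witness A s ρ e ds
  witness (A ∧ⁿ B) s ρ (∧ʳ e)   ds       = witness B s ρ e ds
  witness (A ∨ⁿ B) s ρ (∨ˡ e)   ds       = witness A s ρ e ds
  witness (A ∨ⁿ B) s ρ (∨ʳ e)   ds       = witness B s ρ e ds

  predᴵ⁺ : (P : PredSym Sg⁺) → Vec (Δ I) (par P) → Set
  predᴵ⁺ ≈ᵈ      = predᴵ ≈ᵈ
  predᴵ⁺ (prd P) = predᴵ (prd P)

  -- Passing to representatives makes the Skolem functions compatible with ≈,
  -- which need not be the identity.
  funᴵ⁺ : (f : Fun⁺) → All Expr (Signature.objArgs Sg⁺ f) → Vec (Δ I) (Signature.arity Sg⁺ f) → Δ I
  funᴵ⁺ (base f)     Es ds = funᴵ f Es ds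
  funᴵ⁺ (skolem o e) Es ds = witness (matrix o) (assign (objVars o) Es)
    (Vec.take (scope o) (reps ds)) e (Vec.drop (scope o) (reps ds))
  funᴵ⁺ input        Es ds = a

  I⁺ : Structure Sg⁺
  I⁺ = record
    { Δ        = Δ I
    ; nonempty = nonempty
    ; ν₀ᴵ      = ν₀ᴵ
    ; νᴵ       = νᴵ
    ; funᴵ     = funᴵ⁺
    ; predᴵ    = predᴵ⁺
    ; eqᴵ      = eqᴵ
    }

  open Structure I⁺ public using () renaming (⟦_⟧ᵀ to ⟦_⟧⁺ᵀ; ⟦_⟧ᵀs to ⟦_⟧⁺ᵀs; ⟦_⟧ᴬ to ⟦_⟧⁺ᴬ)
  module Evaluation⁺ = Evaluation I⁺
  open Evaluation⁺ public using () renaming (⟦_⟧ᴸ to ⟦_⟧⁺ᴸ)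

  module _ {X : Set} {s : Subst} {ρ : X → Δ I} where

    ⟦lift⟧ᵀ  : ∀ t → ⟦ liftᵀ t ⟧⁺ᵀ s ρ ≡ ⟦ t ⟧ᵀ s ρ
    ⟦lift⟧ᵀs : ∀ {n} (ts : Vec (Term Sg X) n) → ⟦ liftᵀs ts ⟧⁺ᵀs s ρ ≡ ⟦ ts ⟧ᵀs s ρ
    ⟦lift⟧ᵀ (var x)       = refl
    ⟦lift⟧ᵀ (ν₀ E)        = refl
    ⟦lift⟧ᵀ (fun f Es ts) = cong (funᴵ f (Es [ s ]ᴱs)) (⟦lift⟧ᵀs ts)
    ⟦lift⟧ᵀs []           = refl
    ⟦lift⟧ᵀs (t ∷ ts)     = cong₂ _∷_ (⟦lift⟧ᵀ t) (⟦lift⟧ᵀs ts)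

    ⟦lift⟧ᴬ : ∀ A → ⟦ liftᴬ A ⟧⁺ᴬ s ρ ≡ ⟦ A ⟧ᴬ s ρ
    ⟦lift⟧ᴬ (ν n E ts)        = cong (νᴵ n _) (⟦lift⟧ᵀs ts)
    ⟦lift⟧ᴬ (pred ≈ᵈ ts)      = cong (predᴵ ≈ᵈ) (⟦lift⟧ᵀs ts)
    ⟦lift⟧ᴬ (pred (prd P) ts) = cong (predᴵ (prd P)) (⟦lift⟧ᵀs ts)
    ⟦lift⟧ᴬ (E ≈ᵒ F)          = refl

    ⟦lift⟧ᴸ : ∀ l → ⟦ liftᴸ l ⟧⁺ᴸ s ρ ≡ ⟦ l ⟧ᴸ s ρ
    ⟦lift⟧ᴸ (pos A) = ⟦lift⟧ᴬ A
    ⟦lift⟧ᴸ (neg A) = cong ¬_ (⟦lift⟧ᴬ A)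

  module _ {s s′ : Subst} {δ : ℕ → Δ I} where

    ⟦_⟧ᴰ : DNF → Set
    ⟦ D ⟧ᴰ = Any (All λ l → ⟦ l ⟧⁺ᴸ s δ) D

    -- Induction on `A` under three invariants: `s′`, as seen by the Skolem functions, agrees with
    -- `s` on the variables of `A`; the values `ρ` are those of `env` up to `≈`; and the Skolem
    -- terms denote exactly the witnesses computed from representatives.
    clauses-true : ∀ {k} (A : NNF k) {ρ : Vec (Δ I) k} {env sk next} →
      All (Agree s′ s) (objVarsⁿ A) →
      (∀ i → Vec.lookup ρ i ≈ ⟦ Vec.lookup env i ⟧⁺ᵀ s δ) →
      (∀ e ts → ⟦ sk e ts ⟧⁺ᵀ s δ ≡ witness A s′ ρ e (reps (⟦ ts ⟧⁺ᵀs s δ))) →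
      ⟦ A ⟧ⁿ s′ ρ → ⟦ clauses A env sk next ⟧ᴰ
    clauses-true (lit l) ag hρ hsk p = here (subst (λ P → P)
      (sym (trans (Evaluation⁺.⟦[]⟧ᴸ (λ _ _ → refl) (λ _ → refl) (liftᴸ l)) (⟦lift⟧ᴸ l)))
      (⟦⟧ᴸ-cong hρ l ag p) ∷ [])
    clauses-true ⊤ⁿ ag hρ hsk p = here []
    clauses-true (A ∧ⁿ B) ag hρ hsk (p , q) =
      let agA , agB = All.++⁻ (objVarsⁿ A) ag in
      Any.cartesianProductWith⁺ _++_ All.++⁺
        (clauses-true A agA hρ (hsk ∘ ∧ˡ) p) (clauses-true B agB hρ (hsk ∘ ∧ʳ) q)
    clauses-true (A ∨ⁿ B) ag hρ hsk (inj₁ p) =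
      Any.++⁺ˡ (clauses-true A (proj₁ (All.++⁻ (objVarsⁿ A) ag)) hρ (hsk ∘ ∨ˡ) p)
    clauses-true (A ∨ⁿ B) ag hρ hsk (inj₂ p) =
      Any.++⁺ʳ _ (clauses-true B (proj₂ (All.++⁻ (objVarsⁿ A) ag)) hρ (hsk ∘ ∨ʳ) p)
    clauses-true (∀ⁿ A) {next = next} ag hρ hsk p =
      -- The universal formula is used at the representative of the value of `next`, as this is what
      -- the Skolem functions below it see.
      clauses-true A ag (λ { zero → rep-≈ (δ next) ; (suc i) → hρ i })
        (λ e ts → hsk (in-∀ e) (var next ∷ ts)) (p (rep (δ next)))
    clauses-true (∃ⁿ A) ag hρ hsk p =
      -- By `hsk here []` the Skolem term denotes the chosen element, which satisfies `A` because
      -- `p` shows that some element does.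
      clauses-true A ag (λ { zero → ≈-reflexive (sym (hsk here [])) ; (suc i) → hρ i })
        (hsk ∘ in-∃) (choose-satisfies _ p)

  -- The valuation as the Skolem functions of `o` rebuild it from their arguments; it sends every
  -- other variable to itself.
  skolemSubst : Source → Subst → Subst
  skolemSubst o s = assign (objVars o) (varsFrom (objVars o) [ s ]ᴱs)

  dnf-true : ∀ o {s : Subst} {δ : ℕ → Δ I} → let s′ = skolemSubst o s in
    All (Agree s′ s) (objVarsⁿ (matrix o)) →
    ⟦ matrix o ⟧ⁿ s′ (reps (⟦ xs ⟧⁺ᵀs s δ)) →
    Any (All λ l → ⟦ l ⟧⁺ᴸ s δ) (dnf o)
  dnf-true o {s} {δ} ag = clauses-true (matrix o) ag
    (λ i → ≈-trans
      (≈-reflexive (lookup-map i rep (⟦ xs ⟧⁺ᵀs s δ)))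
      (≈-trans (rep-≈ _) (≈-reflexive (sym (Evaluation⁺.⟦lookup⟧ xs i)))))
    λ e ts → cong₂ (λ ρ ds → witness (matrix o) (skolemSubst o s) ρ e ds)
      (trans (cong (Vec.take (scope o)) (split ts)) (take-++ (reps (⟦ xs ⟧⁺ᵀs s δ)) _))
      (trans (cong (Vec.drop (scope o)) (split ts)) (drop-++ {m = scope o} (reps (⟦ xs ⟧⁺ᵀs s δ)) _))
    where
    split : ∀ {n} (ts : Vec RTerm n) → reps (⟦ xs {scope o} Vec.++ ts ⟧⁺ᵀs s δ) ≡
      reps (⟦ xs ⟧⁺ᵀs s δ) Vec.++ reps (⟦ ts ⟧⁺ᵀs s δ)
    split ts = trans (cong reps (Evaluation⁺.⟦++⟧ xs ts)) (map-++ rep (⟦ xs ⟧⁺ᵀs s δ) (⟦ ts ⟧⁺ᵀs s δ))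

  -- Soundness of the rules in the expanded model.

  module Soundness (N : Normalised S) where
    open Normalised N

    Sound : Rule → Set
    Sound R = ∀ (s : Subst) (δ : ℕ → Δ I) →
      All (λ l → ⟦ l ⟧⁺ᴸ s δ) (Rule.premises R) →
      Any (All λ l → ⟦ l ⟧⁺ᴸ s δ) (Rule.denominators R)

    skolem-agree : ∀ o {s} {us : List ObjVar} → (∀ {w} → w ∈ us → w ∈ objVars o) →
      All (Agree (skolemSubst o s) s) us
    skolem-agree o us⊆ = All.tabulate λ w∈ → assign-varsFrom (objVars o) (us⊆ w∈)

    -- Congruence moves the main premise to representatives, and agreement on `E` moves it to `s′`.
    -- There the sentence of the specification gives `φ`, hence its normal form and a true clause.
    plus-sound : ∀ {n E φ Q} → S⁺ (ξ₊ n E φ) → Sound ((pos (ν n E xs) ∷ Q) / dnf (plus n E φ))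
    plus-sound {n} {E} {φ} ξ∈ s δ (p ∷ _) = dnf-true o
      (subst (All _) (sym (objVarsⁿ-nnf true φ)) (proj₂ agree))
      (nnf-true em φ (∀*-elim (rank n) (I⊨S (proj₂ union (inj₁ ξ∈)) s′) ds
        (subst₂ (νᴵ n) (sym ([]ᴱ-cong E (proj₁ (All.++⁻ (varsᴱ E) (proj₁ agree)))))
          (sym (⟦x̄⟧ ds)) (replace⇒cong (νᴵ n _) (ν-replace n) (≈-reps _) p))))
      where
      o  = plus n E φ
      s′ = skolemSubst o s
      ds = reps (⟦ xs {rank n} ⟧⁺ᵀs s δ)
      agree = All.++⁻ (varsᴬ (ν n E x̄)) (subst (All (Agree s′ s))
        (freeObj-∀* (rank n)) (skolem-agree o (∈-deduplicate⁺ _≟ᵒ_)))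

    -- If `φ` held at the representatives, the specification would give the `ν` atom there, and
    -- congruence would carry it back to the original arguments, against the premise.
    minus-sound : ∀ {n E φ Q} → S⁻ (ξ₋ n E φ) → Sound ((neg (ν n E xs) ∷ Q) / dnf (minus n E φ))
    minus-sound {n} {E} {φ} ξ∈ s δ (p ∷ _) = dnf-true o
      (subst (All _) (sym (objVarsⁿ-nnf false φ)) (proj₁ agree))
      (nnf-false em φ λ q → p (replace⇒cong (νᴵ n _) (ν-replace n) (reps-≈ _)
        (subst₂ (νᴵ n) ([]ᴱ-cong E (proj₁ (All.++⁻ (varsᴱ E) (proj₂ agree))))
          (⟦x̄⟧ ds) (∀*-elim (rank n) (I⊨S (proj₂ union (inj₂ (inj₁ ξ∈))) s′) ds q))))
      where
      o  = minus n E φ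
      s′ = skolemSubst o s
      ds = reps (⟦ xs {rank n} ⟧⁺ᵀs s δ)
      agree = All.++⁻ (freeObj φ) (subst (All (Agree s′ s))
        (freeObj-∀* (rank n)) (skolem-agree o (∈-deduplicate⁺ _≟ᵒ_)))

    back-sound : ∀ {χ Q} → Sᵇ χ → Sound (Q / dnf (back χ))
    back-sound {χ} χ∈ s δ _ = dnf-true o
      (subst (All _) (sym (objVarsⁿ-nnf true χ)) (skolem-agree o (∈-deduplicate⁺ _≟ᵒ_)))
      (nnf-true em χ (I⊨S (proj₂ union (inj₂ (inj₂ χ∈))) (skolemSubst o s)))
      where o = back χ

    pred-replace⁺ : ∀ P {ds} i {d} → predᴵ⁺ P ds → Vec.lookup ds i ≈ d → predᴵ⁺ P (ds [ i ]≔ d)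
    pred-replace⁺ ≈ᵈ      = pred-replace ≈ᵈ
    pred-replace⁺ (prd P) = pred-replace (prd P)

    reps-replace : ∀ {n} (ds : Vec (Δ I) n) i {d} → Vec.lookup ds i ≈ d → reps (ds [ i ]≔ d) ≡ reps ds
    reps-replace ds i {d} q = trans (map-[]≔ rep ds i)
      (trans (cong (reps ds [ i ]≔_) (trans (sym (rep-cong q)) (sym (lookup-map i rep ds))))
             ([]≔-lookup (reps ds) i))

    -- A Skolem function sees only representatives, so its value does not change at all; `input` has
    -- no argument position `i`.
    fun-replace⁺ : ∀ f Es ds i {d} → Vec.lookup ds i ≈ d → funᴵ⁺ f Es ds ≈ funᴵ⁺ f Es (ds [ i ]≔ d)
    fun-replace⁺ (base f)     Es ds i q = fun-replace f Es ds i q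
    fun-replace⁺ (skolem o e) Es ds i q = ≈-reflexive (cong
      (λ ds → witness (matrix o) (assign (objVars o) Es) (Vec.take (scope o) ds) e (Vec.drop (scope o) ds))
      (sym (reps-replace ds i q)))

    module _ {s : Subst} {δ : ℕ → Δ I} where

      refl-true : ∀ {n} (ts : Vec RTerm n) →
        All (λ l → ⟦ l ⟧⁺ᴸ s δ) (Vec.toList (Vec.map (λ t → pos (t ≐ᵈ t)) ts))
      refl-true []       = []
      refl-true (t ∷ ts) = ≈-refl ∷ refl-true ts

      symbol-refl : ∀ {A R} → SymbolAtom A R → All (λ l → ⟦ l ⟧⁺ᴸ s δ) R
      symbol-refl (νˢ n)    = eq-refl _ ∷ refl-true xs
      symbol-refl (predˢ P) = refl-true xs
      symbol-refl (≈ᵒˢ i)   = eq-refl _ ∷ eq-refl _ ∷ []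

      ⟦lookup-xs⟧ : ∀ {n d} (i : Fin n) →
        ⟦ Vec.lookup xs i ⟧⁺ᵀ s δ ≈ d → Vec.lookup (⟦ xs ⟧⁺ᵀs s δ) i ≈ d
      ⟦lookup-xs⟧ {d = d} i = subst (_≈ d) (Evaluation⁺.⟦lookup⟧ xs i)

    T-sound : ∀ {R} → T N R → Sound R
    T-sound (plus-rule ξ∈)       = plus-sound ξ∈
    T-sound (minus-rule ξ∈)      = minus-sound ξ∈
    T-sound (back-rule χ∈ _)     = back-sound χ∈
    T-sound (refl-rule b A)      s δ _                = here (symbol-refl A)
    T-sound symᵈ-rule            s δ (p ∷ [])         = here (≈-sym p ∷ [])
    T-sound (symᵒ-rule i)        s δ (p ∷ [])         = here (eq-sym p ∷ [])
    T-sound transᵈ-rule          s δ (p ∷ q ∷ [])     = here (≈-trans p q ∷ [])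
    T-sound (transᵒ-rule i)      s δ (p ∷ q ∷ [])     = here (eq-trans p q ∷ [])
    T-sound (cong-≈ᵒˡ-rule i)    s δ (p ∷ q ∷ [])     = here (eq-trans (eq-sym q) p ∷ [])
    T-sound (cong-≈ᵒʳ-rule i)    s δ (p ∷ q ∷ [])     = here (eq-trans p q ∷ [])
    T-sound (congᴾ-rule P i)     s δ (p ∷ q ∷ [])     = here (subst (predᴵ⁺ P)
      (sym (Evaluation⁺.⟦[]≔⟧ xs i (y (par P)))) (pred-replace⁺ P i p (⟦lookup-xs⟧ i q)) ∷ [])
    T-sound (congν-rule n i)     s δ (p ∷ q ∷ [])     = here (subst (νᴵ n _)
      (sym (Evaluation⁺.⟦[]≔⟧ xs i (y (rank n)))) (ν-replace n i p (⟦lookup-xs⟧ i q)) ∷ [])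
    T-sound (congᶠ-rule f i)     s δ (_ ∷ q ∷ [])     = here (≈-trans
      (fun-replace⁺ f _ _ i (⟦lookup-xs⟧ i q))
      (≈-reflexive (cong (funᴵ⁺ f _) (sym (Evaluation⁺.⟦[]≔⟧ xs i (y (Signature.arity Sg⁺ f)))))) ∷ [])
    T-sound (closure-rule A)     s δ (p ∷ ¬p ∷ [])    = contradiction p ¬p

    True : GLit → Set
    True l = ⟦ l ⟧⁺ᴸ (λ _ → var) ⊥-elim

    -- Truth of a ground instance is truth of the schematic literal under the valuation read off
    -- from the instantiation, which reduces applications to `Sound`.
    True-inst : ∀ (b : Application) l → let open Application b in
      True (l [ objs , doms ]ᴸ) ≡ ⟦ l ⟧⁺ᴸ objs λ x → ⟦ doms x ⟧⁺ᵀ (λ _ → var) ⊥-elim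
    True-inst b l = Evaluation⁺.⟦[]⟧ᴸ (λ i j → []ᴱ-identity _) (λ _ → refl) l

    application-sound : ∀ b → T N (Application.rule b) →
      All True (Application.premises b) → Any (All True) (Application.denominators b)
    application-sound b R∈ ps = Any.map⁺ (Any.map
      (λ ds → All.map⁺ (All.map (λ {l} → subst (λ P → P) (sym (True-inst b l))) ds))
      (T-sound R∈ _ _ (All.map (λ {l} → subst (λ P → P) (True-inst b l)) (All.map⁻ ps))))

    input-true : ∀ {𝒮 : Pred Concept 0ℓ} → (∀ {C} → 𝒮 C → I ⊩ a ∶ C) → ∀ {l} → inputSet 𝒮 l → True l
    input-true sat (C , C∈ , refl) = subst (λ C → I ⊩ a ∶ C) (sym ([]ᴱ-identity C)) (sat C∈)

-- Construction of a branch with true nodes.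

module TrueBranch (em : ExcludedMiddle 0ℓ) {𝓛 : Language} {Sg : Signature 𝓛} where
  open Calculus Sg

  module _ {rules : Pred Rule 0ℓ} {Γ : Pred GLit 0ℓ} (t : Tableau rules Γ) (True : GLit → Set)
    (sound : ∀ a → rules (Application.rule a) →
      All True (Application.premises a) → Any (All True) (Application.denominators a))
    (Γ-true : ∀ {l} → Γ l → True l) where
    open Tableau t

    GoodChild : Address → ℕ → Set
    GoodChild α j = Node (j ∷ α) × (∀ {l} → label (j ∷ α) l → True l)

    pick : Address → Maybe ℕ
    pick α with em {P = ∃ (GoodChild α)}
    ... | yes (j , _) = just j
    ... | no _        = nothing

    pick-good : ∀ {α j} → pick α ≡ just j → GoodChild α j
    pick-good {α} e with em {P = ∃ (GoodChild α)} | e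
    ... | yes (_ , g) | refl = g

    pick-exists : ∀ {α} → ∃ (GoodChild α) → ∃[ j ] pick α ≡ just j
    pick-exists {α} g with em {P = ∃ (GoodChild α)}
    ... | yes (j , _) = j , refl
    ... | no ¬g       = contradiction g ¬g

    -- Addresses list their last step first, so the recursion climbs to the root and requires every
    -- step to be the picked one.
    B : Pred Address 0ℓ
    B []      = ⊤
    B (j ∷ α) = B α × pick α ≡ just j

    B-node : ∀ {α} → B α → Node α
    B-node {[]}    _       = root
    B-node {j ∷ α} (_ , e) = proj₁ (pick-good e)

    B-true : ∀ {α l} → B α → label α l → True l
    B-true {[]}    _       = Γ-true
    B-true {j ∷ α} (_ , e) = proj₂ (pick-good e)

    B-linear : ∀ α β → B α → B β → α ≼ β ⊎ β ≼ α
    B-linear α []      _  _        = inj₂ (α , sym (++-identityʳ α))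
    B-linear α (j ∷ β) Bα (Bβ , e) with B-linear α β Bα Bβ
    ... | inj₁ (γ , β≡)   = inj₁ (j ∷ γ , cong (j ∷_) β≡)
    -- The last entry of `γ` is the step that `α` takes directly below `β`; since `α` lies on `B`,
    -- it is the picked one, `j`.
    ... | inj₂ (γ , refl) with initLast γ
    ...   | []       = inj₁ (j ∷ [] , refl)
    ...   | γ′ ∷ʳ′ k = inj₂ (γ′ , trans (++-assoc γ′ (k ∷ []) β) (cong (λ k → γ′ ++ k ∷ β) k≡j))
      where
      below : ∀ γ {k} → B ((γ ++ k ∷ []) ++ β) → pick β ≡ just k
      below []      (_ , e) = e
      below (_ ∷ γ) (b , _) = below γ b
      k≡j : k ≡ j
      k≡j = just-injective (trans (sym (below γ′ Bα)) e)

    applied-good : ∀ {α a} → B α → step α ≡ just a → Any (All True) (Application.denominators a)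
    applied-good Bα e =
      let R∈ , ps = applicable (B-node Bα) e in sound _ R∈ (All.map (B-true Bα) ps)

    child-exists : ∀ {α a} → B α → step α ≡ just a → ∃ (GoodChild α)
    child-exists {α} {a} Bα e =
      toℕ j , child (B-node Bα) e j , good
      where
      -- The position of a denominator that soundness makes true.
      j = Any.index (applied-good Bα e)
      good : ∀ {l} → label (toℕ j ∷ α) l → True l
      good (inj₁ l∈) = B-true Bα l∈
      good {l} (inj₂ l∈) with subst (λ m → added m (toℕ j) l) e l∈
      ... | i , i≡j , l∈i with toℕ-injective i≡j
      ...   | refl = All.lookup (Any.lookup-index (applied-good Bα e)) l∈i

    -- Both addresses have the same length, so neither properly extends the other.
    same-head : ∀ {i j α} → (i ∷ α) ≼ (j ∷ α) → i ≡ j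
    same-head ([] , refl) = refl
    same-head {i} {j} {α} (_ ∷ γ , e) = ⊥-elim (m≢1+n+m (length α) (begin
      length α                       ≡⟨ cong length (∷-injectiveʳ e) ⟩
      length (γ ++ i ∷ α)            ≡⟨ length-++ γ ⟩
      length γ ℕ.+ suc (length α)    ≡⟨ +-suc (length γ) (length α) ⟩
      suc (length γ ℕ.+ length α)    ∎))
      where open ≡-Reasoning

    -- For maximality, a node `j ∷ α` of a larger path has its parent on `B` by induction. That
    -- parent has a step, so `B` continues to some `k ∷ α`; both successors lie on one path, which
    -- forces `k` to be `j`.
    B-isBranch : IsBranch rules t B
    B-isBranch = record { nodes = B-node ; fromRoot = proj₁ ; linear = B-linear _ _ } , maximal
      where
      maximal : ∀ B′ → IsPath rules t B′ → B ⊆ B′ → B′ ⊆ B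
      maximal B′ path B⊆ {[]}    _  = _
      maximal B′ path B⊆ {j ∷ α} b′ with IsPath.nodes path b′
      ... | child _ e j′ = Bα , subst (λ j → pick α ≡ just j) k≡j pick≡
        where
        Bα : B α
        Bα = maximal B′ path B⊆ (IsPath.fromRoot path b′)
        k = proj₁ (pick-exists (child-exists Bα e))
        pick≡ = proj₂ (pick-exists (child-exists Bα e))
        k≡j : k ≡ j
        k≡j with IsPath.linear path (B⊆ {k ∷ α} (Bα , pick≡)) b′
        ... | inj₁ k≼j = same-head k≼j
        ... | inj₂ j≼k = sym (same-head j≼k)

    -- A closure rule applied on `B` would have a true denominator, but it has none.
    B-open : ¬ ClosedBranch rules t B
    B-open (α , Bα , a , e , closure) with Rule.denominators (Application.rule a) | closure | applied-good Bα e
    ... | [] | refl | ()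

    open-tableau : Open rules t
    open-tableau closed = B-open (closed B B-isBranch)

theorem5p1 : ExcludedMiddle 0ℓ → Choice →
    ∀ {ℓ} (𝓛 : Language) (Sg : Signature 𝓛) →
    let open Object 𝓛
        open FO {𝓛}
        open Calculus Sg in
    (L : Pred Concept ℓ) → IsLogic L →
    (S : Pred (Sentence Sg) 0ℓ) → IsSemanticSpec S → S IsSpecOf L → (N : Normalised S) →
    (𝒮 : Pred Concept 0ℓ) → (∃ λ I → (I ⊨∀ᴾ S) × Satisfiable I 𝒮) →
    (t : Tableau (T N) (inputSet 𝒮)) → Finished (T N) t → Open (T N) t
theorem5p1 em choice 𝓛 Sg L _ S spec _ N 𝒮 (I , I⊨S , a , sat) t _ =
  TrueBranch.open-tableau em t True application-sound (input-true sat)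
  where
  -- The element `a` at which all of `𝒮` holds becomes the value of `input`.
  open Expansion.Soundness em choice I {S}
    (Calculus.IsSemanticSpec.hasEqAxioms spec) I⊨S a N
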